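{- For every integer $s\ge 3$ there is a constant $c=c(s)>0$ such that for all integers $n\ge 2$, $$f_{s,s+1}(n)\le c(\log n)^{4s^2}\sqrt{n}.$$
   Context: For integers $2\le s<t$ and $n\ge1$, $f_{s,t}(n)$ denotes the minimum, over all $K_t$-free graphs $G$ on $n$ vertices, of the maximum size of a set $W\subseteq V(G)$ such that the induced subgraph $G[W]$ contains no copy of $K_s$. Here $\log$ is the natural logarithm. -}

module Defs where

open import Data.Nat using (ℕ; _≤_; _*_; _^_)
open import Data.Fin using (Fin)
open import Data.Fin.Subset using (Subset; _∈_; ∣_∣)
open import Data.Bool using (Bool; true; false)
open import Data.Product using (Σ; _×_)
open import Relation.Binary.PropositionalEquality using (_≡_; _≢_)
open import Relation.Nullary using (¬_)
open import Function.Definitions using (Injective)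

record Graph (n : ℕ) : Set where
  field
    adj   : Fin n → Fin n → Bool
    sym   : ∀ i j → adj i j ≡ adj j i
    irrefl : ∀ i → adj i i ≡ false
open Graph public

IsClique : ∀ {n s} → Graph n → (Fin s → Fin n) → Set
IsClique G φ = Injective _≡_ _≡_ φ × (∀ i j → i ≢ j → adj G (φ i) (φ j) ≡ true)

KFree : ∀ {n} → ℕ → Graph n → Set
KFree t G = ¬ Σ (Fin t → Fin _) λ φ → IsClique G φ

KFreeIn : ∀ {n} → ℕ → Graph n → Subset n → Set
KFreeIn s G W = ¬ Σ (Fin s → Fin _) λ φ → IsClique G φ × (∀ i → φ i ∈ W)

-- "f_{s,t}(n) ≤ B" with B given through its square: B² = Bsq.
-- f_{s,t}(n) = min over K_t-free G on n vertices of max{|W| : G[W] K_s-free};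
-- so f_{s,t}(n)² ≤ Bsq  iff  some K_t-free G has every such W with |W|² ≤ Bsq.
fSqLe : ℕ → ℕ → ℕ → ℕ → Set
fSqLe s t n Bsq = Σ (Graph n) λ G → KFree t G ×
  (∀ (W : Subset n) → KFreeIn s G W → ∣ W ∣ * ∣ W ∣ ≤ Bsq)

{-# OPTIONS --safe #-}

-- Place the vertices on an N × N integer grid with N² ≈ n and consider the lines of M ≈ log n slopes;
-- two lines of different slopes share at most one vertex. Split the vertices of every line into R random
-- classes, R a power of log n, and colour them with s random colours. Two vertices of one class of a line
-- are joined if their colours differ, unless the pair is dirty: some vertex off the line shares a class
-- with each of the two. Deleting dirty pairs makes every clique collinear, so s colours allow no K_{s+1}.
-- A union bound over k-subsets of lines shows that for some choice of classes no k collinear vertices are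
-- pairwise dirty, k a power of log n: that would need more independent coincidences of classes than the
-- union bound loses. By Ramsey's theorem every set of polylogarithmic size in a class then contains s
-- pairwise clean vertices, so a set W of size √n · polylog n contains, for every slope, |W| / 2s or so
-- disjoint clean s-sets. Each is rainbow, hence a K_s, with probability at least s^-s, independently; with
-- M ≈ log n slopes this beats a union bound over all W.
module Submission where

open import Defs hiding (sym)
open import Data.Nat
  using (ℕ; zero; suc; pred; _≤_; _<_; _+_; _*_; _^_; _/_; _%_; ⌊_/2⌋; ⌈_/2⌉; z≤n; s≤s;
         NonZero; >-nonZero; _<?_; _≤?_)
open import Data.Nat.DivMod using (m≡m%n+[m/n]*n; m%n<n; m<n*o⇒m/o<n)
open import Data.Nat.Logarithm using (⌈log₂_⌉; ⌈log₂⌉-mono-≤; ⌈log₂⌈n/2⌉⌉≡⌈log₂n⌉∸1)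
open import Data.Nat.Properties hiding (suc-injective)
open import Data.Nat.Solver using (module +-*-Solver)
open import Data.Bool using (if_then_else_; true; false)
open import Data.Empty using (⊥; ⊥-elim)
open import Data.Fin as Fin
  using (Fin; zero; suc; toℕ; fromℕ<; inject≤; combine; remQuot; finToFun; funToFin)
open import Data.Fin.Properties
  using (all?; any?; suc-injective; toℕ-injective; toℕ<n; fromℕ<-injective; inject≤-injective;
         combine-injective; combine-remQuot; remQuot-combine; finToFun-funToFin; pigeonhole)
  renaming (_≟_ to _≟ᶠ_)
open import Data.Fin.Subset using (Subset; ∣_∣) renaming (_∈_ to _∈ₛ_)
open import Data.List using (List; []; _∷_; length; filter; tabulate; allFin)
open import Data.List.Properties using (length-tabulate; filter-all)
open import Data.List.Membership.Propositional using (_∈_)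
open import Data.List.Membership.Propositional.Properties using (∈-filter⁻; ∈-tabulate⁻)
open import Data.List.Relation.Unary.All as All using ()
open import Data.List.Relation.Unary.AllPairs using ([]; _∷_)
open import Data.List.Relation.Unary.Any using (here; there)
open import Data.List.Relation.Unary.Unique.Propositional using (Unique)
open import Data.List.Relation.Unary.Unique.Propositional.Properties using (filter⁺; allFin⁺; tabulate⁺)
open import Data.Product using (Σ; ∃; _×_; _,_; proj₁; proj₂)
open import Data.Sum using (_⊎_; inj₁; inj₂)
open import Data.Vec using (Vec; []; _∷_; here; there; lookup; _[_]≔_)
open import Data.Vec.Properties using (lookup∘update; lookup∘update′)
open import Function using (_∘_; mk⇔)
open import Relation.Binary using (tri<; tri≈; tri>)
open import Relation.Binary.PropositionalEquality
open import Relation.Nullary using (¬_; Dec; yes; no; does; ¬?)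
open import Relation.Nullary.Decidable using (_×-dec_; _→-dec_; does-⇔; dec-true; dec-false)
open import Algebra.Properties.Semiring.Sum +-*-semiring
  using (sum; sum-cong-≗; ∑-comm; *-distribˡ-sum)

-- Expectations over a uniformly random vector, as unnormalised sums

sum-mono-≤ : ∀ {n} {f g : Fin n → ℕ} → (∀ i → f i ≤ g i) → sum f ≤ sum g
sum-mono-≤ {zero}  f≤g = z≤n
sum-mono-≤ {suc n} f≤g = +-mono-≤ (f≤g zero) (sum-mono-≤ (f≤g ∘ suc))

sum-const : ∀ n b → sum {n} (λ _ → b) ≡ n * b
sum-const zero    b = refl
sum-const (suc n) b = cong (b +_) (sum-const n b)

term≤sum : ∀ {n} (f : Fin n → ℕ) i → f i ≤ sum f
term≤sum f zero    = m≤m+n _ _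
term≤sum f (suc i) = ≤-trans (term≤sum (f ∘ suc) i) (m≤n+m _ _)

sum<⇒∃< : ∀ n {f : Fin n → ℕ} b → sum f < n * b → ∃ λ i → f i < b
sum<⇒∃< (suc n) {f} b lt with f zero <? b
... | yes f₀<b = zero , f₀<b
... | no  f₀≮b =
  let i , fi<b = sum<⇒∃< n b (+-cancelˡ-< b _ _ (≤-<-trans (+-monoˡ-≤ _ (≮⇒≥ f₀≮b)) lt))
  in suc i , fi<b

prod : ∀ {n} → (Fin n → ℕ) → ℕ
prod {zero}  f = 1
prod {suc n} f = f zero * prod (f ∘ suc)

prod-cong : ∀ {n} {f g : Fin n → ℕ} → f ≗ g → prod f ≡ prod g
prod-cong {zero}  eq = refl
prod-cong {suc n} eq = cong₂ _*_ (eq zero) (prod-cong (eq ∘ suc))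

prod-ones : ∀ {n} {f : Fin n → ℕ} → (∀ i → f i ≡ 1) → prod f ≡ 1
prod-ones {zero}  eq = refl
prod-ones {suc n} eq = cong₂ _*_ (eq zero) (prod-ones (eq ∘ suc))

sumV : ∀ {r} K → (Vec (Fin r) K → ℕ) → ℕ
sumV zero    F = F []
sumV (suc K) F = sum λ a → sumV K (λ x → F (a ∷ x))

sumV-cong : ∀ {r} K {F G : Vec (Fin r) K → ℕ} → F ≗ G → sumV K F ≡ sumV K G
sumV-cong zero    eq = eq []
sumV-cong (suc K) eq = sum-cong-≗ λ a → sumV-cong K (eq ∘ (a ∷_))

sumV-mono-≤ : ∀ {r} K {F G : Vec (Fin r) K → ℕ} → (∀ x → F x ≤ G x) → sumV K F ≤ sumV K G
sumV-mono-≤ zero    le = le []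
sumV-mono-≤ (suc K) le = sum-mono-≤ λ a → sumV-mono-≤ K (le ∘ (a ∷_))

sumV-const : ∀ r K → sumV {r} K (λ _ → 1) ≡ r ^ K
sumV-const r zero    = refl
sumV-const r (suc K) = trans (sum-cong-≗ {r} λ _ → sumV-const r K) (sum-const r (r ^ K))

sumV-*ˡ : ∀ {r} K c (F : Vec (Fin r) K → ℕ) → sumV K (λ x → c * F x) ≡ c * sumV K F
sumV-*ˡ zero    c F = refl
sumV-*ˡ {r} (suc K) c F = trans
  (sum-cong-≗ λ a → sumV-*ˡ K c (F ∘ (a ∷_)))
  (sym (*-distribˡ-sum {r} c (λ a → sumV K (F ∘ (a ∷_)))))

sumV-sum : ∀ {r} K {E} (F : Fin E → Vec (Fin r) K → ℕ) →
  sumV K (λ x → sum λ e → F e x) ≡ sum λ e → sumV K (F e)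
sumV-sum zero    F = refl
sumV-sum {r} (suc K) {E} F = trans
  (sum-cong-≗ λ a → sumV-sum K (λ e → F e ∘ (a ∷_)))
  (∑-comm {r} {E} (λ a e → sumV K (F e ∘ (a ∷_))))

sumV<⇒∃< : ∀ {r} K {F : Vec (Fin r) K → ℕ} b → sumV K F < r ^ K * b → ∃ λ x → F x < b
sumV<⇒∃< zero {F} b lt = [] , subst (F [] <_) (*-identityˡ b) lt
sumV<⇒∃< {r} (suc K) {F} b lt =
  let a , lt₁ = sum<⇒∃< r {λ a → sumV K (F ∘ (a ∷_))} (r ^ K * b)
                  (subst (sumV (suc K) F <_) (*-assoc r (r ^ K) b) lt)
      x , lt₂ = sumV<⇒∃< K b lt₁
  in a ∷ x , lt₂

-- Every vector arises as `x [ y ]≔ a` from exactly `r` pairs: `a` is forced and the entry of `x` at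
-- `y` is free.
sumV-update : ∀ {r} K (y : Fin K) (F : Vec (Fin r) K → ℕ) →
  sumV K (λ x → sum λ a → F (x [ y ]≔ a)) ≡ r * sumV K F
sumV-update {r} (suc K) zero F = trans
  (sum-const r _) (cong (r *_) (sumV-sum K (λ a → F ∘ (a ∷_))))
sumV-update {r} (suc K) (suc y) F = trans
  (sum-cong-≗ λ a → sumV-update K y (F ∘ (a ∷_)))
  (sym (*-distribˡ-sum {r} r (λ a → sumV K (F ∘ (a ∷_)))))

-- `r ^ length T` times the conditional expectation of `F` given the entries outside `T`.
resample : ∀ {r K} → List (Fin K) → (Vec (Fin r) K → ℕ) → Vec (Fin r) K → ℕ
resample []      F x = F x
resample (y ∷ T) F x = sum λ a → resample T F (x [ y ]≔ a)

sumV-resample : ∀ {r K} (T : List (Fin K)) (F : Vec (Fin r) K → ℕ) →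
  sumV K (resample T F) ≡ r ^ length T * sumV K F
sumV-resample []      F = sym (*-identityˡ _)
sumV-resample {r} {K} (y ∷ T) F = begin
  sumV K (resample (y ∷ T) F)         ≡⟨ sumV-update K y (resample T F) ⟩
  r * sumV K (resample T F)           ≡⟨ cong (r *_) (sumV-resample T F) ⟩
  r * (r ^ length T * sumV K F)       ≡⟨ *-assoc r _ _ ⟨
  r ^ length (y ∷ T) * sumV K F       ∎
  where open ≡-Reasoning

-- Taking out what is known: a factor that ignores the entries in `T` leaves the conditional
-- expectation.
resample-*ʳ : ∀ {r K} (T : List (Fin K)) (t F : Vec (Fin r) K → ℕ) →
  (∀ {y} → y ∈ T → ∀ a x → F (x [ y ]≔ a) ≡ F x) →
  ∀ x → resample T (λ z → t z * F z) x ≡ resample T t x * F x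
resample-*ʳ []      t F inv x = refl
resample-*ʳ {r} (y ∷ T) t F inv x = begin
  (sum λ a → resample T (λ z → t z * F z) (x [ y ]≔ a))
    ≡⟨ (sum-cong-≗ λ a → trans (resample-*ʳ T t F (inv ∘ there) (x [ y ]≔ a))
         (trans (*-comm _ (F (x [ y ]≔ a)))
           (cong (_* resample T t (x [ y ]≔ a)) (inv (here refl) a x)))) ⟩
  (sum λ a → F x * resample T t (x [ y ]≔ a))
    ≡⟨ *-distribˡ-sum {r} (F x) (λ a → resample T t (x [ y ]≔ a)) ⟨
  F x * resample (y ∷ T) t x
    ≡⟨ *-comm (F x) _ ⟩
  resample (y ∷ T) t x * F x ∎
  where open ≡-Reasoning

-- Integrating out the variables of the first factor leaves the remaining factors untouched,
-- so the factors behave like independent events of probability α / r ^ l.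
sumV-prod-≤ : ∀ {r K} l α q (T : Fin q → List (Fin K)) (t : Fin q → Vec (Fin r) K → ℕ) →
  (∀ p → length (T p) ≡ l) →
  (∀ p x → resample (T p) (t p) x ≤ α) →
  (∀ p p′ → p ≢ p′ → ∀ {y} → y ∈ T p → ∀ a x → t p′ (x [ y ]≔ a) ≡ t p′ x) →
  (r ^ l) ^ q * sumV K (λ x → prod λ p → t p x) ≤ α ^ q * r ^ K
sumV-prod-≤ {r} {K} l α zero T t len bound inv =
  *-monoʳ-≤ 1 (≤-reflexive (sumV-const r K))
sumV-prod-≤ {r} {K} l α (suc q) T t len bound inv = begin
  r ^ l * B * sumV K (λ x → t zero x * F x)
    ≡⟨ trans (cong (_* sumV K (λ x → t zero x * F x)) (*-comm (r ^ l) B)) (*-assoc B (r ^ l) _) ⟩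
  B * (r ^ l * sumV K (λ x → t zero x * F x))
    ≡⟨ cong (λ k → B * (r ^ k * sumV K (λ x → t zero x * F x))) (len zero) ⟨
  B * (r ^ length (T zero) * sumV K (λ x → t zero x * F x))
    ≡⟨ cong (B *_) (sumV-resample (T zero) (λ x → t zero x * F x)) ⟨
  B * sumV K (resample (T zero) (λ x → t zero x * F x))
    ≤⟨ *-monoʳ-≤ B (sumV-mono-≤ K step) ⟩
  B * sumV K (λ x → α * F x)
    ≡⟨ cong (B *_) (sumV-*ˡ K α F) ⟩
  B * (α * sumV K F)
    ≡⟨ trans (sym (*-assoc B α _)) (trans (cong (_* sumV K F) (*-comm B α)) (*-assoc α B _)) ⟩
  α * (B * sumV K F)
    ≤⟨ *-monoʳ-≤ α (sumV-prod-≤ l α q (T ∘ suc) (t ∘ suc) (len ∘ suc) (bound ∘ suc)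
         (λ p p′ p≢p′ → inv (suc p) (suc p′) (p≢p′ ∘ suc-injective))) ⟩
  α * (α ^ q * r ^ K)
    ≡⟨ *-assoc α _ _ ⟨
  α ^ suc q * r ^ K ∎
  where
  open ≤-Reasoning
  B = (r ^ l) ^ q
  F : Vec (Fin r) K → ℕ
  F x = prod λ p → t (suc p) x
  step : ∀ x → resample (T zero) (λ z → t zero z * F z) x ≤ α * F x
  step x = begin
    resample (T zero) (λ z → t zero z * F z) x
      ≡⟨ resample-*ʳ (T zero) (t zero) F
           (λ y∈ a z → prod-cong λ p → inv zero (suc p) (λ ()) y∈ a z) x ⟩
    resample (T zero) (t zero) x * F x
      ≤⟨ *-monoˡ-≤ (F x) (bound zero x) ⟩
    α * F x ∎

-- First moment: the average of the total weight is at most `E * A / B < 1`, so some `x` has total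
-- weight below 1, and weights are natural numbers.
union-bound : ∀ {r K} .{{_ : NonZero r}} A B E (F : Fin E → Vec (Fin r) K → ℕ) →
  (∀ e → B * sumV K (F e) ≤ A * r ^ K) → E * A < B → ∃ λ x → ∀ e → F e x ≡ 0
union-bound {r} {K} A B E F bound lt =
  let x , Σ<1 = sumV<⇒∃< K 1 total
  in x , λ e → n≤0⇒n≡0 (≤-trans (term≤sum (λ e → F e x) e) (≤-pred Σ<1))
  where
  open ≤-Reasoning
  instance _ = m^n≢0 r K
  total : sumV K (λ x → sum λ e → F e x) < r ^ K * 1
  total = *-cancelˡ-< B _ _ (begin-strict
    B * sumV K (λ x → sum λ e → F e x) ≡⟨ cong (B *_) (sumV-sum K F) ⟩
    B * (sum λ e → sumV K (F e))       ≡⟨ *-distribˡ-sum B (λ e → sumV K (F e)) ⟩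
    (sum λ e → B * sumV K (F e))       ≤⟨ sum-mono-≤ bound ⟩
    (sum {E} λ _ → A * r ^ K)          ≡⟨ sum-const E _ ⟩
    E * (A * r ^ K)                    ≡⟨ *-assoc E A _ ⟨
    E * A * r ^ K                      <⟨ *-monoˡ-< (r ^ K) lt ⟩
    B * r ^ K                          ≡⟨ cong (B *_) (*-identityʳ _) ⟨
    B * (r ^ K * 1)                    ∎)

-- Avoiding coded families of independent events

ind : ∀ {P : Set} → Dec P → ℕ
ind P? = if does P? then 1 else 0

ind-yes : ∀ {P : Set} (P? : Dec P) → P → ind P? ≡ 1
ind-yes (yes _) _ = refl
ind-yes (no ¬p) p = ⊥-elim (¬p p)

ind-no : ∀ {P : Set} (P? : Dec P) → ¬ P → ind P? ≡ 0
ind-no (yes p) ¬p = ⊥-elim (¬p p)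
ind-no (no _)  _  = refl

ind≤1 : ∀ {P : Set} (P? : Dec P) → ind P? ≤ 1
ind≤1 (yes _) = ≤-refl
ind≤1 (no _)  = z≤n

ind-cong : ∀ {P Q : Set} (P? : Dec P) (Q? : Dec Q) → (P → Q) → (Q → P) → ind P? ≡ ind Q?
ind-cong P? (yes q) f g = ind-yes P? (g q)
ind-cong P? (no ¬q) f g = ind-no P? (¬q ∘ f)

-- `Fin E` is a set of codes, and a code may describe a configuration whose trials are not
-- independent. Such codes fail `V` and get weight 0, so `E` may count all codes while the
-- probabilistic hypotheses concern only the valid ones.
avoid-all : ∀ {r K} .{{_ : NonZero r}} l α q E → E * α ^ q < (r ^ l) ^ q →
  (T : Fin E → Fin q → List (Fin K)) (P : Fin E → Fin q → Vec (Fin r) K → Set) →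
  (P? : ∀ e p x → Dec (P e p x)) (V : Fin E → Set) → (∀ e → Dec (V e)) →
  (∀ e p → length (T e p) ≡ l) →
  (∀ e → V e → ∀ p x → resample (T e p) (λ z → ind (P? e p z)) x ≤ α) →
  (∀ e → V e → ∀ p p′ → p ≢ p′ → ∀ {y} → y ∈ T e p → ∀ a x →
    (P e p′ (x [ y ]≔ a) → P e p′ x) × (P e p′ x → P e p′ (x [ y ]≔ a))) →
  ∃ λ x → ∀ e → V e → ¬ (∀ p → P e p x)
avoid-all {r} {K} l α q E lt T P P? V V? len bound inv =
  let x , F≡0 = union-bound (α ^ q) ((r ^ l) ^ q) E F weight lt
  in x , λ e v all → 1≢0 (trans (sym (F≡1 e v all)) (F≡0 e))
  where
  1≢0 : 1 ≢ 0
  1≢0 ()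
  F : Fin E → Vec (Fin r) K → ℕ
  F e x with V? e
  ... | yes _ = prod λ p → ind (P? e p x)
  ... | no  _ = 0
  F≡1 : ∀ e {x} → V e → (∀ p → P e p x) → F e x ≡ 1
  F≡1 e {x} v all with V? e
  ... | yes _ = prod-ones λ p → ind-yes (P? e p x) (all p)
  ... | no ¬v = ⊥-elim (¬v v)
  weight : ∀ e → (r ^ l) ^ q * sumV K (F e) ≤ α ^ q * r ^ K
  weight e with V? e
  ... | yes v = sumV-prod-≤ l α q (T e) (λ p z → ind (P? e p z)) (len e) (bound e v)
                  λ p p′ ne y∈ a x → let f , g = inv e v p p′ ne y∈ a x in
                    ind-cong (P? e p′ _) (P? e p′ _) f g
  ... | no  _ = ≤-trans (≤-reflexive (trans
    (cong ((r ^ l) ^ q *_) (sumV-*ˡ {r} K 0 (λ _ → 0))) (*-zeroʳ ((r ^ l) ^ q)))) z≤n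

sum-ind-≟ : ∀ {r} (b : Fin r) → sum (λ a → ind (a ≟ᶠ b)) ≤ 1
sum-ind-≟ {suc r} zero = s≤s (≤-reflexive (trans
  (sum-cong-≗ {r} λ a → ind-no (suc a ≟ᶠ zero) λ ()) (trans (sum-const r 0) (*-zeroʳ r))))
sum-ind-≟ {suc r} (suc b) = ≤-trans
  (≤-reflexive (sum-cong-≗ λ a → ind-cong (suc a ≟ᶠ suc b) (a ≟ᶠ b) suc-injective (cong suc)))
  (sum-ind-≟ b)

injective? : ∀ {m n} (y : Fin m → Fin n) → Dec (∀ p p′ → y p ≡ y p′ → p ≡ p′)
injective? y = all? λ p → all? λ p′ → (y p ≟ᶠ y p′) →-dec (p ≟ᶠ p′)

-- Given all other entries, the entry at `y e p` equals the one at `g e p` with probability `1 / r`.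
-- The `q` coincidences are independent since each has its own entry `y e p`, which no other trial
-- reads; the `g e p` may repeat.
avoid-coincidences : ∀ {r K} .{{_ : NonZero r}} q E → E < r ^ q → (y g : Fin E → Fin q → Fin K) →
  ∃ λ (x : Vec (Fin r) K) → ∀ e →
    (∀ p p′ → y e p ≡ y e p′ → p ≡ p′) → (∀ p p′ → g e p ≢ y e p′) →
    ¬ (∀ p → lookup x (y e p) ≡ lookup x (g e p))
avoid-coincidences {r} {K} q E lt y g =
  let x , avoids = avoid-all 1 1 q E lt′ (λ e p → y e p ∷ [])
        (λ e p x → lookup x (y e p) ≡ lookup x (g e p))
        (λ e p x → lookup x (y e p) ≟ᶠ lookup x (g e p))
        (λ e → (∀ p p′ → y e p ≡ y e p′ → p ≡ p′) × (∀ p p′ → g e p ≢ y e p′))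
        (λ e → injective? (y e) ×-dec all? λ p → all? λ p′ → ¬? (g e p ≟ᶠ y e p′))
        (λ _ _ → refl) bound inv
  in x , λ e i ne → avoids e (i , ne)
  where
  lt′ : E * 1 ^ q < (r ^ 1) ^ q
  lt′ = subst₂ _<_ (sym (trans (cong (E *_) (^-zeroˡ q)) (*-identityʳ E)))
    (cong (_^ q) (sym (*-identityʳ r))) lt
  bound : ∀ e → _ → ∀ p x →
    sum (λ a → ind (lookup (x [ y e p ]≔ a) (y e p) ≟ᶠ lookup (x [ y e p ]≔ a) (g e p))) ≤ 1
  bound e (_ , ne) p x = ≤-trans (≤-reflexive (sum-cong-≗ λ a →
    ind-cong (lookup (x [ y e p ]≔ a) (y e p) ≟ᶠ lookup (x [ y e p ]≔ a) (g e p))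
      (a ≟ᶠ lookup x (g e p))
      (λ eq → trans (sym (lookup∘update (y e p) x a)) (trans eq (lookup∘update′ (ne p p) x a)))
      (λ eq → trans (lookup∘update (y e p) x a) (trans eq (sym (lookup∘update′ (ne p p) x a))))))
    (sum-ind-≟ (lookup x (g e p)))
  inv : ∀ e → _ → ∀ p p′ → p ≢ p′ → ∀ {z} → z ∈ y e p ∷ [] → ∀ a x → _
  inv e (i , ne) p p′ p≢p′ (here refl) a x =
    let y-eq = lookup∘update′ (λ eq → p≢p′ (sym (i p′ p eq))) x a
        g-eq = lookup∘update′ (ne p′ p) x a
    in (λ eq → trans (sym y-eq) (trans eq g-eq)) , (λ eq → trans y-eq (trans eq (sym g-eq)))

resample-≤ : ∀ {r K} (T : List (Fin K)) (F : Vec (Fin r) K → ℕ) → (∀ x → F x ≤ 1) →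
  ∀ x → resample T F x ≤ r ^ length T
resample-≤ []      F F≤1 x = F≤1 x
resample-≤ {r} (y ∷ T) F F≤1 x = ≤-trans
  (sum-mono-≤ λ a → resample-≤ T F F≤1 (x [ y ]≔ a)) (≤-reflexive (sum-const r _))

sum-< : ∀ {n} (f : Fin n → ℕ) b → (∀ i → f i ≤ b) → ∀ i → f i < b → sum f < n * b
sum-< {suc n} f b f≤b zero lt = +-mono-<-≤ lt
  (≤-trans (sum-mono-≤ (f≤b ∘ suc)) (≤-reflexive (sum-const n b)))
sum-< f b f≤b (suc i) lt = +-mono-≤-< (f≤b zero) (sum-< (f ∘ suc) b (f≤b ∘ suc) i lt)

assign : ∀ {r K} s → (Fin s → Fin K) → (Fin s → Fin r) → Vec (Fin r) K → Vec (Fin r) K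
assign zero    y c x = x
assign (suc s) y c x = assign s (y ∘ suc) (c ∘ suc) (x [ y zero ]≔ c zero)

lookup-assign-∉ : ∀ {r K} s (y : Fin s → Fin K) (c : Fin s → Fin r) x z → (∀ t → z ≢ y t) →
  lookup (assign s y c x) z ≡ lookup x z
lookup-assign-∉ zero    y c x z z∉ = refl
lookup-assign-∉ (suc s) y c x z z∉ = trans
  (lookup-assign-∉ s (y ∘ suc) (c ∘ suc) _ z (z∉ ∘ suc)) (lookup∘update′ (z∉ zero) x _)

lookup-assign : ∀ {r K} s (y : Fin s → Fin K) (c : Fin s → Fin r) x →
  (∀ t t′ → y t ≡ y t′ → t ≡ t′) →
  ∀ t → lookup (assign s y c x) (y t) ≡ c t
lookup-assign (suc s) y c x inj zero = trans
  (lookup-assign-∉ s (y ∘ suc) (c ∘ suc) _ (y zero) (λ t eq → 0≢s (inj zero (suc t) eq)))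
  (lookup∘update (y zero) x (c zero))
  where
  0≢s : ∀ {t : Fin s} → Fin.zero ≢ suc t
  0≢s ()
lookup-assign (suc s) y c x inj (suc t) =
  lookup-assign s (y ∘ suc) (c ∘ suc) _ (λ t t′ → suc-injective ∘ inj (suc t) (suc t′)) t

-- Among the `r ^ s` terms, each at most 1, the one that writes `c` is 0.
resample-< : ∀ {r K} s (y : Fin s → Fin K) (c : Fin s → Fin r) (F : Vec (Fin r) K → ℕ) →
  (∀ x → F x ≤ 1) → ∀ x → F (assign s y c x) ≡ 0 → resample (tabulate y) F x < r ^ s
resample-< zero    y c F F≤1 x eq = s≤s (≤-reflexive eq)
resample-< {r} (suc s) y c F F≤1 x eq = sum-< _ (r ^ s)
  (λ a → ≤-trans (resample-≤ (tabulate (y ∘ suc)) F F≤1 (x [ y zero ]≔ a))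
           (≤-reflexive (cong (r ^_) (length-tabulate (y ∘ suc)))))
  (c zero) (resample-< s (y ∘ suc) (c ∘ suc) F F≤1 _ eq)

-- A block of `s` entries misses the pattern `c` with probability at most `α / r ^ s`, and disjoint
-- blocks are independent.
avoid-missed-patterns : ∀ {r K} .{{_ : NonZero r}} s α → suc α ≡ r ^ s →
  ∀ q E → E * α ^ q < (r ^ s) ^ q →
  (y : Fin E → Fin q → Fin s → Fin K) (c : Fin s → Fin r) →
  ∃ λ (x : Vec (Fin r) K) → ∀ e → (∀ p p′ t t′ → y e p t ≡ y e p′ t′ → p ≡ p′ × t ≡ t′) →
    ¬ (∀ p → ¬ (∀ t → lookup x (y e p t) ≡ c t))
avoid-missed-patterns {r} {K} s α α+1 q E lt y c = avoid-all s α q E lt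
  (λ e p → tabulate (y e p)) P P?
  (λ e → ∀ p p′ t t′ → y e p t ≡ y e p′ t′ → p ≡ p′ × t ≡ t′)
  (λ e → all? λ p → all? λ p′ → all? λ t → all? λ t′ →
     (y e p t ≟ᶠ y e p′ t′) →-dec ((p ≟ᶠ p′) ×-dec (t ≟ᶠ t′)))
  (λ e p → length-tabulate (y e p)) bound inv
  where
  P : Fin E → Fin q → Vec (Fin r) K → Set
  P e p x = ¬ (∀ t → lookup x (y e p t) ≡ c t)
  P? : ∀ e p x → Dec (P e p x)
  P? e p x = ¬? (all? λ t → lookup x (y e p t) ≟ᶠ c t)
  bound : ∀ e → (∀ p p′ t t′ → y e p t ≡ y e p′ t′ → p ≡ p′ × t ≡ t′) →
    ∀ p x → resample (tabulate (y e p)) (λ z → ind (P? e p z)) x ≤ α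
  bound e inj p x = ≤-pred (subst (resample (tabulate (y e p)) (λ z → ind (P? e p z)) x <_) (sym α+1)
    (resample-< s (y e p) c (λ z → ind (P? e p z)) (λ z → ind≤1 (P? e p z)) x
      (ind-no (P? e p (assign s (y e p) c x)) λ missed →
        missed (lookup-assign s (y e p) c x λ t t′ eq → proj₂ (inj p p t t′ eq)))))
  inv : ∀ e → (∀ p p′ t t′ → y e p t ≡ y e p′ t′ → p ≡ p′ × t ≡ t′) →
    ∀ p p′ → p ≢ p′ → ∀ {z} → z ∈ tabulate (y e p) → ∀ a x →
    (P e p′ (x [ z ]≔ a) → P e p′ x) × (P e p′ x → P e p′ (x [ z ]≔ a))
  inv e inj p p′ p≢p′ z∈ a x with ∈-tabulate⁻ z∈
  ... | t , refl =
    (λ missed hit → missed λ t′ → trans (same t′) (hit t′)) ,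
    (λ missed hit → missed λ t′ → trans (sym (same t′)) (hit t′))
    where
    same : ∀ t′ → lookup (x [ y e p t ]≔ a) (y e p′ t′) ≡ lookup x (y e p′ t′)
    same t′ = lookup∘update′ (λ eq → p≢p′ (sym (proj₁ (inj p′ p t′ t eq)))) x a

-- Finite combinatorics of lists

length-filter-split : ∀ {A : Set} {P : A → Set} (P? : ∀ x → Dec (P x)) xs →
  length (filter P? xs) + length (filter (¬? ∘ P?) xs) ≡ length xs
length-filter-split P? []       = refl
length-filter-split P? (x ∷ xs) with P? x
... | yes _ = cong suc (length-filter-split P? xs)
... | no  _ = trans (+-suc _ _) (cong suc (length-filter-split P? xs))

-- `T` need not be injective; where distinct elements are wanted, `Q` contains the inequality.
Pairwise : {A : Set} → (A → A → Set) → ℕ → List A → Set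
Pairwise {A} Q r xs =
  Σ (Fin r → A) λ T → (∀ a → T a ∈ xs) × (∀ a b → a ≢ b → Q (T a) (T b))

pairwise-∷ : ∀ {A : Set} {Q : A → A → Set} {r x xs ys} → Pairwise Q r ys →
  (∀ {y} → y ∈ ys → y ∈ xs × Q x y × Q y x) → Pairwise Q (suc r) (x ∷ xs)
pairwise-∷ {A} {Q} {r} {x} {xs} (T , T∈ , T-pw) rel = T′ , T′∈ , pw
  where
  T′ : Fin (suc r) → A
  T′ zero    = x
  T′ (suc a) = T a
  T′∈ : ∀ a → T′ a ∈ x ∷ xs
  T′∈ zero    = here refl
  T′∈ (suc a) = there (proj₁ (rel (T∈ a)))
  pw : ∀ a b → a ≢ b → Q (T′ a) (T′ b)
  pw zero    zero    a≢b = ⊥-elim (a≢b refl)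
  pw zero    (suc b) a≢b = proj₁ (proj₂ (rel (T∈ b)))
  pw (suc a) zero    a≢b = proj₂ (proj₂ (rel (T∈ a)))
  pw (suc a) (suc b) a≢b = T-pw a b (a≢b ∘ cong suc)

pairwise-⊆ : ∀ {A : Set} {Q : A → A → Set} {r xs ys} →
  (∀ {y} → y ∈ ys → y ∈ xs) → Pairwise Q r ys → Pairwise Q r xs
pairwise-⊆ sub (T , T∈ , T-pw) = T , sub ∘ T∈ , T-pw

unique⇒pairwise-≢ : ∀ {A : Set} r {xs : List A} → Unique xs → r ≤ length xs → Pairwise _≢_ r xs
unique⇒pairwise-≢ zero    u r≤ = (λ ()) , (λ ()) , λ ()
unique⇒pairwise-≢ (suc r) {x ∷ xs} (x∉ ∷ u) (s≤s r≤) =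
  pairwise-∷ (unique⇒pairwise-≢ r u r≤) λ y∈ → y∈ , All.lookup x∉ y∈ , All.lookup x∉ y∈ ∘ sym

-- The Erdős-Szekeres recursion. The `suc` pays for the pivot, whose neighbours and non-neighbours
-- share the remaining elements.
ramseyBound : ℕ → ℕ → ℕ
ramseyBound zero    b       = 0
ramseyBound (suc r) zero    = 0
ramseyBound (suc r) (suc b) = suc (ramseyBound r (suc b) + ramseyBound (suc r) b)

ramsey : ∀ {A : Set} {D : A → A → Set} (D? : ∀ u v → Dec (D u v)) → (∀ {u v} → D u v → D v u) →
  ∀ r b xs → Unique xs → ramseyBound r b ≤ length xs →
  Pairwise (λ u v → u ≢ v × ¬ D u v) r xs ⊎ Pairwise (λ u v → u ≢ v × D u v) b xs
ramsey D? D-sym zero    b       xs u le = inj₁ ((λ ()) , (λ ()) , λ ())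
ramsey D? D-sym (suc r) zero    xs u le = inj₂ ((λ ()) , (λ ()) , λ ())
ramsey {D = D} D? D-sym (suc r) (suc b) (x ∷ xs) (x∉ ∷ u) (s≤s le)
  with ramseyBound r (suc b) ≤? length (filter (¬? ∘ D? x) xs)
... | yes le₁ with ramsey D? D-sym r (suc b) _ (filter⁺ (¬? ∘ D? x) u) le₁
...   | inj₁ T = inj₁ (pairwise-∷ T λ y∈f →
          let y∈ , ¬d = ∈-filter⁻ (¬? ∘ D? x) {xs = xs} y∈f; x≢y = All.lookup x∉ y∈
          in y∈ , (x≢y , ¬d) , (x≢y ∘ sym , ¬d ∘ D-sym))
...   | inj₂ U = inj₂ (pairwise-⊆ {Q = λ u v → u ≢ v × D u v}
          (there ∘ proj₁ ∘ ∈-filter⁻ (¬? ∘ D? x) {xs = xs}) U)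
ramsey {D = D} D? D-sym (suc r) (suc b) (x ∷ xs) (x∉ ∷ u) (s≤s le)
    | no ≰ with ramsey D? D-sym (suc r) b _ (filter⁺ (D? x) u)
                  (+-cancelˡ-≤ (ramseyBound r (suc b)) _ _
                    (≤-trans le (≤-trans (≤-reflexive (sym (length-filter-split (D? x) xs)))
                      (≤-trans (≤-reflexive (+-comm (length (filter (D? x) xs)) _))
                        (+-monoˡ-≤ _ (≰⇒≥ ≰))))))
...   | inj₁ T = inj₁ (pairwise-⊆ {Q = λ u v → u ≢ v × ¬ D u v}
          (there ∘ proj₁ ∘ ∈-filter⁻ (D? x) {xs = xs}) T)
...   | inj₂ U = inj₂ (pairwise-∷ U λ y∈f →
          let y∈ , d = ∈-filter⁻ (D? x) {xs = xs} y∈f; x≢y = All.lookup x∉ y∈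
          in y∈ , (x≢y , d) , (x≢y ∘ sym , D-sym d))

-- For fixed `r` the bound is polynomial in `b`, hence polylogarithmic when `b` is. Strictness
-- absorbs the `suc` of the recursion.
ramseyBound-< : ∀ r b → ramseyBound r b < suc b ^ r
ramseyBound-< zero    b       = s≤s z≤n
ramseyBound-< (suc r) zero    = m^n>0 1 (suc r)
ramseyBound-< (suc r) (suc b) = begin-strict
  suc (ramseyBound r (suc b) + ramseyBound (suc r) b)
    <⟨ s≤s (+-mono-≤ (ramseyBound-< r (suc b)) (≤-refl)) ⟩
  suc (suc (suc b) ^ r + ramseyBound (suc r) b)
    ≡⟨ +-suc _ _ ⟨
  suc (suc b) ^ r + suc (ramseyBound (suc r) b)
    ≤⟨ +-monoʳ-≤ (suc (suc b) ^ r) (ramseyBound-< (suc r) b) ⟩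
  suc (suc b) ^ r + suc b * suc b ^ r
    ≤⟨ +-monoʳ-≤ (suc (suc b) ^ r) (*-monoʳ-≤ (suc b) (^-monoˡ-≤ r (n≤1+n (suc b)))) ⟩
  suc (suc b) ^ suc r ∎
  where open ≤-Reasoning

-- If the class of the largest value has at most `b` elements, discarding it costs one of the `q`
-- portions of size `b`.
pigeonhole-list : ∀ {A : Set} q b (κ : A → ℕ) xs → Unique xs → (∀ {x} → x ∈ xs → κ x < q) →
  q * b < length xs →
  ∃ λ j → Σ (List A) λ ys → Unique ys × b < length ys × (∀ {y} → y ∈ ys → y ∈ xs × κ y ≡ j)
pigeonhole-list zero    b κ (x ∷ xs) u κ< lt with () ← κ< (here refl)
pigeonhole-list (suc q) b κ xs u κ< lt with b <? length (filter (λ x → κ x ≟ q) xs)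
... | yes b<  = q , _ , filter⁺ _ u , b< , ∈-filter⁻ _ {xs = xs}
... | no ≮ =
  let j , ys , u′ , b< , ys-in = pigeonhole-list q b κ (filter (λ x → ¬? (κ x ≟ q)) xs) (filter⁺ _ u)
        (λ x∈f → let x∈ , κ≢q = ∈-filter⁻ _ {xs = xs} x∈f in ≤∧≢⇒< (≤-pred (κ< x∈)) κ≢q)
        (+-cancelˡ-< b _ _ (<-≤-trans lt
          (≤-trans (≤-reflexive (sym (length-filter-split (λ x → κ x ≟ q) xs))) (+-monoˡ-≤ _ (≮⇒≥ ≮)))))
  in j , ys , u′ , b< , λ y∈ → let y∈f , eq = ys-in y∈ in proj₁ (∈-filter⁻ _ {xs = xs} y∈f) , eq

length-filter-≢ : ∀ {n} (x : Fin n) {xs} → Unique xs →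
  length xs ≤ suc (length (filter (λ y → ¬? (y ≟ᶠ x)) xs))
length-filter-≢ x {[]}     u = z≤n
length-filter-≢ x {y ∷ xs} (y∉ ∷ u) with y ≟ᶠ x
... | yes refl = s≤s (≤-reflexive (cong length
                   (sym (filter-all (λ z → ¬? (z ≟ᶠ x)) (All.map (_∘ sym) y∉)))))
... | no  _    = s≤s (length-filter-≢ x u)

remove : ∀ {n} s (T : Fin s → Fin n) xs → Unique xs →
  Σ (List (Fin n)) λ ys → Unique ys × length xs ≤ s + length ys ×
    (∀ {y} → y ∈ ys → y ∈ xs × (∀ t → y ≢ T t))
remove zero    T xs u = xs , u , ≤-refl , λ y∈ → y∈ , λ ()
remove {n} (suc s) T xs u =
  let f = filter (λ y → ¬? (y ≟ᶠ T zero)) xs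
      ys , u′ , len , ys-in = remove s (T ∘ suc) f (filter⁺ _ u)
  in ys , u′ , ≤-trans (length-filter-≢ (T zero) u) (s≤s len) , λ y∈ →
     let y∈f , ne = ys-in y∈
         y∈xs , ne₀ = ∈-filter⁻ (λ y → ¬? (y ≟ᶠ T zero)) {xs = xs} y∈f
     in y∈xs , λ { zero → ne₀ ; (suc t) → ne t }

-- Greedy choice: `find` works while more than `m` elements remain, and removing a block costs at
-- most `s` of them.
disjoint-blocks : ∀ {n} s m (Good : (Fin s → Fin n) → Set) → 0 < s →
  (∀ xs → Unique xs → m < length xs →
    Σ (Fin s → Fin n) λ T → Good T × (∀ t → T t ∈ xs) × (∀ t t′ → T t ≡ T t′ → t ≡ t′)) →
  ∀ q xs → Unique xs → m + q * s ≤ length xs →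
  Σ (Fin q → Fin s → Fin n) λ B → (∀ p → Good (B p)) × (∀ p t → B p t ∈ xs) ×
    (∀ p p′ t t′ → B p t ≡ B p′ t′ → p ≡ p′ × t ≡ t′)
disjoint-blocks s m Good 0<s find zero    xs u len = (λ ()) , (λ ()) , (λ ()) , λ ()
disjoint-blocks {n} s m Good 0<s find (suc q) xs u len = B , B-good , B∈ , B-inj
  where
  first = find xs u (<-≤-trans (m<m+n m (≤-trans 0<s (m≤m+n s (q * s)))) len)
  T = proj₁ first
  rest = remove s T xs u
  ys = proj₁ rest
  ys-in = proj₂ (proj₂ (proj₂ rest))
  len′ : m + q * s ≤ length ys
  len′ = +-cancelˡ-≤ s _ _ (begin
    s + (m + q * s) ≡⟨ +-assoc s m _ ⟨
    s + m + q * s   ≡⟨ cong (_+ q * s) (+-comm s m) ⟩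
    m + s + q * s   ≡⟨ +-assoc m s _ ⟩
    m + suc q * s   ≤⟨ len ⟩
    length xs       ≤⟨ proj₁ (proj₂ (proj₂ rest)) ⟩
    s + length ys   ∎)
    where open ≤-Reasoning
  more = disjoint-blocks s m Good 0<s find q ys (proj₁ (proj₂ rest)) len′
  B : Fin (suc q) → Fin s → Fin n
  B zero    = T
  B (suc p) = proj₁ more p
  B-good : ∀ p → Good (B p)
  B-good zero    = proj₁ (proj₂ first)
  B-good (suc p) = proj₁ (proj₂ more) p
  B∈ : ∀ p t → B p t ∈ xs
  B∈ zero    t = proj₁ (proj₂ (proj₂ first)) t
  B∈ (suc p) t = proj₁ (ys-in (proj₁ (proj₂ (proj₂ more)) p t))
  avoids-T : ∀ p t t′ → B (suc p) t ≢ T t′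
  avoids-T p t = proj₂ (ys-in (proj₁ (proj₂ (proj₂ more)) p t))
  B-inj : ∀ p p′ t t′ → B p t ≡ B p′ t′ → p ≡ p′ × t ≡ t′
  B-inj zero    zero     t t′ eq = refl , proj₂ (proj₂ (proj₂ first)) t t′ eq
  B-inj zero    (suc p′) t t′ eq = ⊥-elim (avoids-T p′ t′ t (sym eq))
  B-inj (suc p) zero     t t′ eq = ⊥-elim (avoids-T p t t′ eq)
  B-inj (suc p) (suc p′) t t′ eq =
    let p≡ , t≡ = proj₂ (proj₂ (proj₂ more)) p p′ t t′ eq in cong suc p≡ , t≡

-- The graph of a system of lines

module Lines {n M ℓ : ℕ} (π : Fin M → Fin n → Fin ℓ)
  (π-inj : ∀ {i j u v} → i ≢ j → π i u ≡ π i v → π j u ≡ π j v → u ≡ v) where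

  -- combine i u indexes the random value attached to u as a point of its line π i u of direction i.
  Near : ∀ {R} → Vec (Fin R) (M * n) → Fin M → Fin n → Fin n → Set
  Near c i u v = π i u ≡ π i v × lookup c (combine i u) ≡ lookup c (combine i v)

  near-sym : ∀ {R} (c : Vec (Fin R) (M * n)) {i u v} → Near c i u v → Near c i v u
  near-sym c (p , q) = sym p , sym q

  near? : ∀ {R} (c : Vec (Fin R) (M * n)) i u v → Dec (Near c i u v)
  near? c i u v = (π i u ≟ᶠ π i v) ×-dec (lookup c (combine i u) ≟ᶠ lookup c (combine i v))

  Apex : ∀ {R} → Vec (Fin R) (M * n) → Fin M → Fin n → Fin n → Fin n → Fin M → Fin M → Set
  Apex c i u v w j k = j ≢ i × k ≢ i × w ≢ u × w ≢ v × Near c j u w × Near c k v w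

  Dirty : ∀ {R} → Vec (Fin R) (M * n) → Fin M → Fin n → Fin n → Set
  Dirty c i u v = ∃ λ w → ∃ λ j → ∃ λ k → Apex c i u v w j k

  dirty-sym : ∀ {R} (c : Vec (Fin R) (M * n)) {i u v} → Dirty c i u v → Dirty c i v u
  dirty-sym c (w , j , k , j≢i , k≢i , w≢u , w≢v , uw , vw) =
    w , k , j , k≢i , j≢i , w≢v , w≢u , vw , uw

  dirty? : ∀ {R} (c : Vec (Fin R) (M * n)) i u v → Dec (Dirty c i u v)
  dirty? c i u v = any? λ w → any? λ j → any? λ k →
    ¬? (j ≟ᶠ i) ×-dec ¬? (k ≟ᶠ i) ×-dec ¬? (w ≟ᶠ u) ×-dec ¬? (w ≟ᶠ v) ×-dec
    near? c j u w ×-dec near? c k v w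

  -- Junk value u if the lines π j u and π k v do not meet.
  meet : Fin M → Fin M → Fin n → Fin n → Fin n
  meet j k u v with any? (λ w → (π j u ≟ᶠ π j w) ×-dec (π k v ≟ᶠ π k w))
  ... | yes (w , _) = w
  ... | no  _       = u

  meet-≡ : ∀ {j k u v w} → j ≢ k → π j u ≡ π j w → π k v ≡ π k w → meet j k u v ≡ w
  meet-≡ {j} {k} {u} {v} {w} j≢k eq₁ eq₂ with any? (λ w → (π j u ≟ᶠ π j w) ×-dec (π k v ≟ᶠ π k w))
  ... | yes (w′ , eq₁′ , eq₂′) = π-inj j≢k (trans (sym eq₁′) eq₁) (trans (sym eq₂′) eq₂)
  ... | no  ∄                  = ⊥-elim (∄ (w , eq₁ , eq₂))

  -- Suppose `suc k` points of one line are pairwise dirty. Each point `U a` then yields `suc h`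
  -- coincidences between its own value and that of an apex. The aim is to show that these
  -- `suc k * suc h` apex variables are distinct and differ from the variables of the points, as
  -- `avoid-coincidences` requires.
  module DirtySet {R k h} (c : Vec (Fin R) (M * n)) (M*M*h<k : M * M * h < k) (i : Fin M)
    (U : Fin (suc k) → Fin n) (dirty : ∀ a b → a ≢ b → U a ≢ U b × Dirty c i (U a) (U b))
    (collinear : ∀ a b → π i (U a) ≡ π i (U b)) where

    U-inj : ∀ a b → U a ≡ U b → a ≡ b
    U-inj a b eq with a ≟ᶠ b
    ... | yes a≡b = a≡b
    ... | no  a≢b = ⊥-elim (proj₁ (dirty a b a≢b) eq)

    same : ∀ a b {j} → j ≢ i → π j (U a) ≡ π j (U b) → a ≡ b
    same a b j≢i eq = U-inj a b (π-inj j≢i eq (collinear a b))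

    slopes : ∀ a b → Σ (Fin M × Fin M) λ (j , k) → a ≢ b → ∃ λ w → Apex c i (U a) (U b) w j k
    slopes a b with a ≟ᶠ b
    -- A default that is never reached later: partners of `a` differ from `a`.
    ... | yes a≡b = (i , i) , λ a≢b → ⊥-elim (a≢b a≡b)
    ... | no  a≢b = let w , j , k , apex = proj₂ (dirty a b a≢b) in (j , k) , λ _ → w , apex

    code : Fin (suc k) → Fin (suc k) → Fin (M * M)
    code a b = let j , k = proj₁ (slopes a b) in combine j k

    others : Fin (suc k) → List (Fin (suc k))
    others a = filter (λ b → ¬? (b ≟ᶠ a)) (allFin (suc k))

    -- By pigeonhole, h + 1 of the pairs at a are dirty through the same two directions.
    partners : ∀ a → ∃ λ q → Σ (Fin (suc h) → Fin (suc k)) λ B →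
      (∀ r → a ≢ B r × toℕ (code a (B r)) ≡ q) × (∀ r r′ → B r ≡ B r′ → r ≡ r′)
    partners a =
      let q , ys , u , h< , ys-in = pigeonhole-list (M * M) h (toℕ ∘ code a) (others a)
            (filter⁺ (λ b → ¬? (b ≟ᶠ a)) (allFin⁺ (suc k))) (λ {b} _ → toℕ<n (code a b))
            (<-≤-trans M*M*h<k (≤-pred (≤-trans (≤-reflexive (sym (length-tabulate {n = suc k} (λ b → b))))
              (length-filter-≢ a (allFin⁺ (suc k))))))
          B , B∈ , B-≢ = unique⇒pairwise-≢ (suc h) u h<
      in q , B
       , (λ r → let b∈ , eq = ys-in (B∈ r) in
            proj₂ (∈-filter⁻ (λ b → ¬? (b ≟ᶠ a)) {xs = allFin (suc k)} b∈) ∘ sym , eq)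
       , λ r r′ eq → inj-from-≢ (B-≢ r r′) eq
      where
      inj-from-≢ : ∀ {r r′ : Fin (suc h)} {b b′ : Fin (suc k)} → (r ≢ r′ → b ≢ b′) → b ≡ b′ → r ≡ r′
      inj-from-≢ {r} {r′} f eq with r ≟ᶠ r′
      ... | yes r≡ = r≡
      ... | no  r≢ = ⊥-elim (f r≢ eq)

    partner : Fin (suc k) → Fin (suc h) → Fin (suc k)
    partner a = proj₁ (proj₂ (partners a))

    a≢partner : ∀ a r → a ≢ partner a r
    a≢partner a r = proj₁ (proj₁ (proj₂ (proj₂ (partners a))) r)

    partner-inj : ∀ a r r′ → partner a r ≡ partner a r′ → r ≡ r′
    partner-inj a = proj₂ (proj₂ (proj₂ (partners a)))

    left right : Fin (suc k) → Fin (suc h) → Fin M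
    left  a r = proj₁ (proj₁ (slopes a (partner a r)))
    right a r = proj₂ (proj₁ (slopes a (partner a r)))

    right-const : ∀ a r r′ → right a r ≡ right a r′
    right-const a r r′ = proj₂ (combine-injective (left a r) (right a r) (left a r′) (right a r′)
      (toℕ-injective (trans (code≡ r) (sym (code≡ r′)))))
      where
      code≡ : ∀ r → toℕ (code a (partner a r)) ≡ proj₁ (partners a)
      code≡ r = proj₂ (proj₁ (proj₂ (proj₂ (partners a))) r)

    apex : Fin (suc k) → Fin (suc h) → Fin n
    apex a r = proj₁ (proj₂ (slopes a (partner a r)) (a≢partner a r))

    apex-spec : ∀ a r → Apex c i (U a) (U (partner a r)) (apex a r) (left a r) (right a r)
    apex-spec a r = proj₂ (proj₂ (slopes a (partner a r)) (a≢partner a r))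

    left≢i : ∀ a r → left a r ≢ i
    left≢i a r = let j≢i , _ = apex-spec a r in j≢i

    right≢i : ∀ a r → right a r ≢ i
    right≢i a r = let _ , k≢i , _ = apex-spec a r in k≢i

    π-left : ∀ a r → π (left a r) (U a) ≡ π (left a r) (apex a r)
    π-left a r = let _ , _ , _ , _ , (eq , _) , _ = apex-spec a r in eq

    π-right : ∀ a r → π (right a r) (U (partner a r)) ≡ π (right a r) (apex a r)
    π-right a r = let _ , _ , _ , _ , _ , (eq , _) = apex-spec a r in eq

    left≢right : ∀ a r → left a r ≢ right a r
    left≢right a r eq = a≢partner a r (same a (partner a r) (left≢i a r)
      (trans (π-left a r) (sym (subst (λ j → π j (U (partner a r)) ≡ π j (apex a r)) (sym eq) (π-right a r)))))

    -- This is what the common directions are for: two partners of `a` with the same apex lie on one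
    -- line of the common right direction through it, and also on the line of direction `i`, so they
    -- coincide.
    same-apex : ∀ {a a′} r r′ → a ≡ a′ → apex a r ≡ apex a′ r′ → r ≡ r′
    same-apex {a} r r′ refl w≡ = partner-inj a r r′ (same (partner a r) (partner a r′) (right≢i a r)
      (trans (π-right a r) (trans (cong₂ π (right-const a r r′) w≡)
        (trans (sym (π-right a r′)) (cong (λ j → π j (U (partner a r′))) (right-const a r′ r))))))

    -- A common variable gives a common left direction and a common apex. Both `U a` and `U a′` lie
    -- on that line through the apex and on the line of direction `i`, so they are equal;
    -- `same-apex` then identifies the columns.
    variables-inj : ∀ a r a′ r′ → combine (left a r) (apex a r) ≡ combine (left a′ r′) (apex a′ r′) →
      a ≡ a′ × r ≡ r′
    variables-inj a r a′ r′ eq = a≡ , same-apex r r′ a≡ w≡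
      where
      j≡ = proj₁ (combine-injective (left a r) (apex a r) (left a′ r′) (apex a′ r′) eq)
      w≡ = proj₂ (combine-injective (left a r) (apex a r) (left a′ r′) (apex a′ r′) eq)
      a≡ : a ≡ a′
      a≡ = same a a′ (left≢i a r) (trans (π-left a r) (trans (cong₂ π j≡ w≡)
             (trans (sym (π-left a′ r′)) (cong (λ j → π j (U a′)) (sym j≡)))))

    -- An apex among the `U a′` would share with `U a` both its left line and the line of direction
    -- `i`, hence equal `U a`.
    apex≢U : ∀ a r a′ → apex a r ≢ U a′
    apex≢U a r a′ eq = let _ , _ , w≢u , _ = apex-spec a r in
      w≢u (trans eq (cong U (same a′ a (left≢i a r) (sym (trans (π-left a r) (cong (π (left a r)) eq))))))

    variables-fresh : ∀ a r a′ r′ → combine (left a r) (U a) ≢ combine (left a′ r′) (apex a′ r′)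
    variables-fresh a r a′ r′ eq = apex≢U a′ r′ a
      (sym (proj₂ (combine-injective (left a r) (U a) (left a′ r′) (apex a′ r′) eq)))

    coincidence : ∀ a r → lookup c (combine (left a r) (apex a r)) ≡ lookup c (combine (left a r) (U a))
    coincidence a r = let _ , _ , _ , _ , (_ , eq) , _ = apex-spec a r in sym eq

    meet≡apex : ∀ a r → meet (left a r) (right a r) (U a) (U (partner a r)) ≡ apex a r
    meet≡apex a r = meet-≡ (left≢right a r) (π-left a r) (π-right a r)

    trial : Fin (suc k * suc h) → Fin (suc k * (M * M))
    trial p = let a , r = remQuot {suc k} (suc h) p in combine (partner a r) (combine (left a r) (right a r))

  NoDirtySet : ∀ {R} → ℕ → Vec (Fin R) (M * n) → Set
  NoDirtySet k c = ∀ i (U : Fin k → Fin n) → (∀ a b → a ≢ b → U a ≢ U b × Dirty c i (U a) (U b)) →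
    (∀ a b → π i (U a) ≡ π i (U b)) → ⊥

  -- The number of codes is below `R ^ q` while each valid code has probability at most `R ^ -q`. A
  -- forbidden set would supply, through `DirtySet`, a valid code all of whose coincidences occur.
  exists-classes : ∀ R k h .{{_ : NonZero R}} → M * M * h < k →
    n ^ suc k * (suc k * (M * M)) ^ (suc k * suc h) < R ^ (suc k * suc h) →
    ∃ λ (c : Vec (Fin R) (M * n)) → NoDirtySet (suc k) c
  exists-classes R k h M*M*h<k lt = c , no-dirty
    where
    q = suc k * suc h
    -- An event e encodes vertices U and, for every a and every column r, a partner and two directions;
    -- recovering the apex by meet, instead of storing it, keeps the number E of events below R ^ q.
    Trial = suc k * (M * M)
    E = n ^ suc k * Trial ^ q
    decodeU : Fin E → Fin (suc k) → Fin n
    decodeU e = finToFun (proj₁ (remQuot {n ^ suc k} (Trial ^ q) e))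
    decodeτ : Fin E → Fin q → Fin Trial
    decodeτ e = finToFun (proj₂ (remQuot {n ^ suc k} (Trial ^ q) e))
    row : Fin q → Fin (suc k)
    row p = proj₁ (remQuot {suc k} (suc h) p)
    trialSlopes : Fin Trial → Fin M × Fin M
    trialSlopes τ = remQuot {M} M (proj₂ (remQuot {suc k} (M * M) τ))
    trialPartner : Fin Trial → Fin (suc k)
    trialPartner τ = proj₁ (remQuot {suc k} (M * M) τ)
    g-of y-of : (Fin (suc k) → Fin n) → Fin (suc k) → Fin Trial → Fin (M * n)
    g-of U a τ = combine (proj₁ (trialSlopes τ)) (U a)
    y-of U a τ = let j , k = trialSlopes τ in combine j (meet j k (U a) (U (trialPartner τ)))
    y g : Fin E → Fin q → Fin (M * n)
    g e p = g-of (decodeU e) (row p) (decodeτ e p)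
    y e p = y-of (decodeU e) (row p) (decodeτ e p)
    found = avoid-coincidences {R} {M * n} q E lt y g
    c = proj₁ found
    no-dirty : NoDirtySet (suc k) c
    no-dirty i U dirty collinear = proj₂ found e y-inj g-fresh hit
      where
      open DirtySet c M*M*h<k i U dirty collinear
      e : Fin E
      e = combine (funToFin U) (funToFin trial)
      decoded : remQuot {n ^ suc k} (Trial ^ q) e ≡ (funToFin U , funToFin trial)
      decoded = remQuot-combine {n ^ suc k} {Trial ^ q} (funToFin U) (funToFin trial)
      decodeU≡ : ∀ a → decodeU e a ≡ U a
      decodeU≡ a = trans (cong (λ z → finToFun (proj₁ z) a) decoded) (finToFun-funToFin U a)
      decodeτ≡ : ∀ p → decodeτ e p ≡ trial p
      decodeτ≡ p = trans (cong (λ z → finToFun (proj₂ z) p) decoded) (finToFun-funToFin trial p)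
      col : Fin q → Fin (suc h)
      col p = proj₂ (remQuot {suc k} (suc h) p)
      l r : Fin q → Fin M
      l p = left (row p) (col p)
      r p = right (row p) (col p)
      trial≡ : ∀ p → remQuot {suc k} (M * M) (trial p) ≡ (partner (row p) (col p) , combine (l p) (r p))
      trial≡ p = remQuot-combine {suc k} {M * M} (partner (row p) (col p)) (combine (l p) (r p))
      partner≡ : ∀ p → trialPartner (decodeτ e p) ≡ partner (row p) (col p)
      partner≡ p = trans (cong trialPartner (decodeτ≡ p)) (cong proj₁ (trial≡ p))
      slopes≡ : ∀ p → trialSlopes (decodeτ e p) ≡ (l p , r p)
      slopes≡ p = trans (cong trialSlopes (decodeτ≡ p))
        (trans (cong (remQuot {M} M ∘ proj₂) (trial≡ p)) (remQuot-combine {M} {M} (l p) (r p)))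
      g≡ : ∀ p → g e p ≡ combine (l p) (U (row p))
      g≡ p = cong₂ combine (cong proj₁ (slopes≡ p)) (decodeU≡ (row p))
      y≡ : ∀ p → y e p ≡ combine (l p) (apex (row p) (col p))
      y≡ p = cong₂ combine (cong proj₁ (slopes≡ p)) (trans
        (cong₂ (λ jk → meet (proj₁ jk) (proj₂ jk) (decodeU e (row p))) (slopes≡ p)
           (trans (decodeU≡ _) (cong U (partner≡ p))))
        (trans (cong (λ u → meet (l p) (r p) u (U (partner (row p) (col p)))) (decodeU≡ (row p)))
          (meet≡apex (row p) (col p))))
      y-inj : ∀ p p′ → y e p ≡ y e p′ → p ≡ p′
      y-inj p p′ eq =
        let a≡ , r≡ = variables-inj (row p) (col p) (row p′) (col p′)
                        (trans (sym (y≡ p)) (trans eq (y≡ p′)))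
        in trans (sym (combine-remQuot {suc k} (suc h) p))
             (trans (cong₂ combine a≡ r≡) (combine-remQuot {suc k} (suc h) p′))
      g-fresh : ∀ p p′ → g e p ≢ y e p′
      g-fresh p p′ eq = variables-fresh (row p) (col p) (row p′) (col p′)
        (trans (sym (g≡ p)) (trans eq (y≡ p′)))
      hit : ∀ p → lookup c (y e p) ≡ lookup c (g e p)
      hit p = trans (cong (lookup c) (y≡ p))
        (trans (coincidence (row p) (col p)) (cong (lookup c) (sym (g≡ p))))

  -- The graph and its cliques

  Edge : ∀ {R s} → Vec (Fin R) (M * n) → Vec (Fin s) (M * n) → Fin M → Fin n → Fin n → Set
  Edge c d i u v = Near c i u v × lookup d (combine i u) ≢ lookup d (combine i v) × ¬ Dirty c i u v

  Adjacent : ∀ {R s} → Vec (Fin R) (M * n) → Vec (Fin s) (M * n) → Fin n → Fin n → Set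
  Adjacent c d u v = ∃ λ i → Edge c d i u v

  adjacent-sym : ∀ {R s} (c : Vec (Fin R) (M * n)) (d : Vec (Fin s) (M * n)) {u v} →
    Adjacent c d u v → Adjacent c d v u
  adjacent-sym c d (i , near , d≢ , clean) = i , near-sym c near , d≢ ∘ sym , clean ∘ dirty-sym c

  adjacent? : ∀ {R s} (c : Vec (Fin R) (M * n)) (d : Vec (Fin s) (M * n)) u v → Dec (Adjacent c d u v)
  adjacent? c d u v = any? λ i →
    near? c i u v ×-dec ¬? (lookup d (combine i u) ≟ᶠ lookup d (combine i v)) ×-dec ¬? (dirty? c i u v)

  graph : ∀ {R s} → Vec (Fin R) (M * n) → Vec (Fin s) (M * n) → Graph n
  graph c d = record
    { adj    = λ u v → does (adjacent? c d u v)
    ; sym    = λ u v → does-⇔ (mk⇔ (adjacent-sym c d) (adjacent-sym c d))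
               (adjacent? c d u v) (adjacent? c d v u)
    ; irrefl = λ u → dec-false (adjacent? c d u u) λ (_ , _ , d≢ , _) → d≢ refl
    }

  adj⇒adjacent : ∀ {R s} (c : Vec (Fin R) (M * n)) (d : Vec (Fin s) (M * n)) {u v} →
    adj (graph c d) u v ≡ true → Adjacent c d u v
  adj⇒adjacent c d {u} {v} eq with adjacent? c d u v
  ... | yes a = a
  ... | no _ with () ← eq

  -- Let `i` be the direction of the edge between the first two vertices. A third vertex joined to
  -- both in other directions would make that clean pair dirty, so all vertices share one class of
  -- one line. Two of them have the same colour there, and their edge cannot have another direction
  -- since they already share a line.
  graph-KFree : ∀ {R} s → 0 < s → (c : Vec (Fin R) (M * n)) (d : Vec (Fin s) (M * n)) →
    KFree (suc s) (graph c d)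
  graph-KFree (suc s) _ c d (φ , φ-inj , φ-adj) =
    two-of-one-colour (pigeonhole ≤-refl (λ a → lookup d (combine i (φ a))))
    where
    edge : ∀ a b → a ≢ b → Adjacent c d (φ a) (φ b)
    edge a b a≢b = adj⇒adjacent c d (φ-adj a b a≢b)
    i = proj₁ (edge zero (suc zero) λ ())
    base = proj₂ (edge zero (suc zero) λ ())
    near₀ : ∀ a → Near c i (φ zero) (φ a)
    near₀ zero = refl , refl
    near₀ (suc zero) = proj₁ base
    near₀ (suc (suc a)) with edge zero (suc (suc a)) (λ ()) | edge (suc zero) (suc (suc a)) (λ ())
    ... | j , near₁ , _ | k , near₂ , _ with j ≟ᶠ i | k ≟ᶠ i
    ...   | yes refl | _        = near₁
    ...   | no _     | yes refl = let p , q = proj₁ base; p′ , q′ = near₂ in trans p p′ , trans q q′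
    ...   | no j≢i   | no k≢i   = ⊥-elim (proj₂ (proj₂ base)
            (φ (suc (suc a)) , j , k , j≢i , k≢i , distinct (λ ()) , distinct (λ ()) , near₁ , near₂))
      where
      distinct : ∀ {a b} → a ≢ b → φ a ≢ φ b
      distinct a≢b = a≢b ∘ φ-inj
    two-of-one-colour : (∃ λ a → ∃ λ b → a Fin.< b × lookup d (combine i (φ a)) ≡ lookup d (combine i (φ b))) → ⊥
    two-of-one-colour (a , b , a<b , d≡) with edge a b (λ { refl → <-irrefl refl a<b })
    ... | k , (π≡ , _) , d≢ , _ with k ≟ᶠ i
    ...   | yes refl = d≢ d≡
    ...   | no k≢i   = <-irrefl (cong toℕ (φ-inj (π-inj k≢i π≡
            (trans (sym (proj₁ (near₀ a))) (proj₁ (near₀ b)))))) a<b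

  -- Clean blocks and random colours

  Clean : ∀ {R s} → Vec (Fin R) (M * n) → Fin M → (Fin s → Fin n) → Set
  Clean c i T = ∀ t t′ → t ≢ t′ → Near c i (T t) (T t′) × ¬ Dirty c i (T t) (T t′)

  Injective₂ : ∀ {q s} → (Fin q → Fin s → Fin n) → Set
  Injective₂ B = ∀ p p′ t t′ → B p t ≡ B p′ t′ → p ≡ p′ × t ≡ t′

  CleanBlocks : ∀ {R q s m} → Vec (Fin R) (M * n) → Fin M →
    (Fin m → Fin n) → (Fin q → Fin s → Fin n) → Set
  CleanBlocks c i f B = (∀ p → Clean c i (B p)) × (∀ p t → ∃ λ a → B p t ≡ f a) × Injective₂ B

  -- There are `ℓ * R` cells, a cell being one class of one line. While more than `ℓ * R * K₀`
  -- vertices remain, some cell holds more than `K₀`, and Ramsey's theorem finds `s` pairwise clean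
  -- ones in it: `k` pairwise dirty ones are excluded.
  clean-blocks : ∀ {R} (c : Vec (Fin R) (M * n)) s k K₀ q →
    0 < s → NoDirtySet k c → ramseyBound s k ≤ K₀ →
    ∀ i (f : Fin (ℓ * R * K₀ + q * s) → Fin n) → (∀ a b → f a ≡ f b → a ≡ b) →
    Σ (Fin q → Fin s → Fin n) (CleanBlocks c i f)
  clean-blocks {R} c s k K₀ q 0<s no-dirty bound i f f-inj =
    let B , good , B∈ , inj = disjoint-blocks s (ℓ * R * K₀) (Clean c i) 0<s find q (tabulate f)
          (tabulate⁺ (f-inj _ _)) (≤-reflexive (sym (length-tabulate f)))
    in B , good , (λ p t → ∈-tabulate⁻ (B∈ p t)) , inj
    where
    cell : Fin n → Fin (ℓ * R)
    cell v = combine (π i v) (lookup c (combine i v))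
    cell⇒near : ∀ {u v} → cell u ≡ cell v → Near c i u v
    cell⇒near {u} {v} = combine-injective (π i u) _ (π i v) _
    find : ∀ xs → Unique xs → ℓ * R * K₀ < length xs →
      Σ (Fin s → Fin n) λ T → Clean c i T × (∀ t → T t ∈ xs) × (∀ t t′ → T t ≡ T t′ → t ≡ t′)
    find xs u lt with pigeonhole-list (ℓ * R) K₀ (toℕ ∘ cell) xs u (λ {x} _ → toℕ<n (cell x)) lt
    ... | z , ys , u′ , K₀< , ys-in
      with ramsey (dirty? c i) (dirty-sym c) s k ys u′ (≤-trans bound (<⇒≤ K₀<))
    ...   | inj₁ (T , T∈ , T-pw) =
            T , (λ t t′ t≢t′ → near (T∈ t) (T∈ t′) , proj₂ (T-pw t t′ t≢t′))
              , (λ t → proj₁ (ys-in (T∈ t))) , T-inj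
      where
      near : ∀ {u v} → u ∈ ys → v ∈ ys → Near c i u v
      near u∈ v∈ = cell⇒near (toℕ-injective (trans (proj₂ (ys-in u∈)) (sym (proj₂ (ys-in v∈)))))
      T-inj : ∀ t t′ → T t ≡ T t′ → t ≡ t′
      T-inj t t′ eq with t ≟ᶠ t′
      ... | yes t≡ = t≡
      ... | no  t≢ = ⊥-elim (proj₁ (T-pw t t′ t≢) eq)
    ...   | inj₂ (U , U∈ , U-pw) = ⊥-elim (no-dirty i U U-pw λ a b → proj₁ (cell⇒near
            (toℕ-injective (trans (proj₂ (ys-in (U∈ a))) (sym (proj₂ (ys-in (U∈ b))))))))

  -- The existence of a clique is stated through a double negation: the union bound only refutes
  -- that all blocks fail, and this is enough to refute `KFreeIn`.
  RichIn : ∀ {R s} → Vec (Fin R) (M * n) → Vec (Fin s) (M * n) → ℕ → Set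
  RichIn {s = s} c d m = ∀ (f : Fin m → Fin n) → (∀ a b → f a ≡ f b → a ≡ b) →
    ¬ (∀ (T : Fin s → Fin n) → (∀ t → ∃ λ a → T t ≡ f a) → (∀ t t′ → T t ≡ T t′ → t ≡ t′) →
         ¬ (∀ t t′ → t ≢ t′ → Adjacent c d (T t) (T t′)))

  -- The codes are the maps `f`, and the trials are `q` blocks in each of `M` directions; the blocks
  -- depend on `c` alone, so they are fixed before the colours. Blocks of different directions may
  -- share vertices, but colours belong to a vertex together with a direction, so all `M * q` trials
  -- use different variables.
  exists-colours : ∀ {R} (c : Vec (Fin R) (M * n)) s k K₀ q α .{{_ : NonZero s}} →
    Fin n → 0 < s → NoDirtySet k c → ramseyBound s k ≤ K₀ →
    suc α ≡ s ^ s → let m = ℓ * R * K₀ + q * s in n ^ m * α ^ (M * q) < (s ^ s) ^ (M * q) →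
    ∃ λ (d : Vec (Fin s) (M * n)) → RichIn c d m
  exists-colours {R} c s k K₀ q α v₀ 0<s no-dirty bound α+1 lt = d , spec
    where
    m = ℓ * R * K₀ + q * s
    system : ∀ i (f : Fin m → Fin n) → (∀ a b → f a ≡ f b → a ≡ b) →
      Σ (Fin q → Fin s → Fin n) (CleanBlocks c i f)
    system = clean-blocks c s k K₀ q 0<s no-dirty bound
    blocks : (Fin m → Fin n) → Fin M → Fin q → Fin s → Fin n
    blocks f i with injective? f
    ... | yes inj = proj₁ (system i f inj)
    -- An arbitrary value: `spec` only decodes injective maps.
    ... | no  _   = λ _ _ → v₀
    blocks-spec : ∀ f → (∀ a b → f a ≡ f b → a ≡ b) → ∀ i → CleanBlocks c i f (blocks f i)
    blocks-spec f inj i with injective? f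
    ... | yes inj′ = proj₂ (system i f inj′)
    ... | no ¬inj  = ⊥-elim (¬inj inj)
    slope : Fin (M * q) → Fin M
    slope p = proj₁ (remQuot {M} q p)
    index : Fin (M * q) → Fin q
    index p = proj₂ (remQuot {M} q p)
    y : Fin (n ^ m) → Fin (M * q) → Fin s → Fin (M * n)
    y e p t = combine (slope p) (blocks (finToFun e) (slope p) (index p) t)
    -- Only one rainbow pattern is counted, colour `t` on the vertex `t` of the block; its
    -- probability `s ^ -s` suffices.
    found = avoid-missed-patterns s α α+1 (M * q) (n ^ m) lt y (λ t → t)
    d = proj₁ found
    spec : RichIn c d m
    spec f f-inj none = proj₂ found e y-inj missed
      where
      e = funToFin f
      f′ : Fin m → Fin n
      f′ = finToFun e
      f′≡f : ∀ a → f′ a ≡ f a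
      f′≡f = finToFun-funToFin f
      clean = blocks-spec f′ (λ a b eq → f-inj a b (trans (sym (f′≡f a)) (trans eq (f′≡f b))))
      y-inj : ∀ p p′ t t′ → y e p t ≡ y e p′ t′ → p ≡ p′ × t ≡ t′
      y-inj p p′ t t′ eq =
        let i≡ , b≡ = combine-injective (slope p) (blocks f′ (slope p) (index p) t)
                        (slope p′) (blocks f′ (slope p′) (index p′) t′) eq
            r≡ , t≡ = within (index p) (index p′) t t′ i≡ b≡
        in trans (sym (combine-remQuot {M} q p))
             (trans (cong₂ combine i≡ r≡) (combine-remQuot {M} q p′)) , t≡
        where
        within : ∀ {i i′} r r′ t t′ → i ≡ i′ → blocks f′ i r t ≡ blocks f′ i′ r′ t′ → r ≡ r′ × t ≡ t′
        within r r′ t t′ refl = proj₂ (proj₂ (clean _)) r r′ t t′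
      missed : ∀ p → ¬ (∀ t → lookup d (y e p t) ≡ t)
      missed p rainbow = none (blocks f′ i (index p))
        (λ t → let a , eq = proj₁ (proj₂ (clean i)) (index p) t in a , trans eq (f′≡f a))
        (λ t t′ eq → proj₂ (proj₂ (proj₂ (clean i)) (index p) (index p) t t′ eq))
        λ t t′ t≢t′ → let near , ¬dirty = proj₁ (clean i) (index p) t t′ t≢t′ in
          i , near , (λ eq → t≢t′ (trans (sym (rainbow t)) (trans eq (rainbow t′)))) , ¬dirty
        where i = slope p

-- Lines of the integer grid

enumerate : ∀ {n} (W : Subset n) →
  Σ (Fin ∣ W ∣ → Fin n) λ f → (∀ a b → f a ≡ f b → a ≡ b) × (∀ a → f a ∈ₛ W)
enumerate [] = (λ ()) , (λ ()) , λ ()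
enumerate {suc n} (false ∷ W) =
  let f , f-inj , f∈ = enumerate W in
    suc ∘ f , (λ a b → f-inj a b ∘ suc-injective) , λ a → there (f∈ a)
enumerate {suc n} (true ∷ W) = g , g-inj , g∈
  where
  f = proj₁ (enumerate W)
  g : Fin (suc ∣ W ∣) → Fin (suc n)
  g zero    = zero
  g (suc a) = suc (f a)
  g-inj : ∀ a b → g a ≡ g b → a ≡ b
  g-inj zero    zero    _  = refl
  g-inj (suc a) (suc b) eq = cong suc (proj₁ (proj₂ (enumerate W)) a b (suc-injective eq))
  g∈ : ∀ a → g a ∈ₛ true ∷ W
  g∈ zero    = here
  g∈ (suc a) = there (proj₂ (proj₂ (enumerate W)) a)

-- Two points in different columns determine the slope: `y - y′` is both `i` and `j` times `x′ - x`.
-- Writing `x′` as `suc x + d` avoids subtraction.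
intercept-< : ∀ {x x′ y y′} i j → x < x′ → y + i * x ≡ y′ + i * x′ → y + j * x ≡ y′ + j * x′ → i ≡ j
intercept-< {x} {x′} {y} {y′} i j x<x′ eqᵢ eqⱼ with m≤n⇒∃[o]m+o≡n x<x′
... | d , refl = *-cancelʳ-≡ i j (suc d) (+-cancelˡ-≡ y′ _ _ (trans (sym (shift i eqᵢ)) (shift j eqⱼ)))
  where
  open +-*-Solver
  shift : ∀ i → y + i * x ≡ y′ + i * (suc x + d) → y ≡ y′ + i * suc d
  shift i eq = +-cancelʳ-≡ (i * x) _ _ (trans eq
    (solve 4 (λ y i x d → y :+ i :* (con 1 :+ x :+ d) := (y :+ i :* (con 1 :+ d)) :+ i :* x) refl y′ i x d))

module Grid (N M n : ℕ) .{{_ : NonZero N}} (n≤N*N : n ≤ N * N) where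

  -- The vertex `u` is the grid point with column `toℕ u / N` and row `toℕ u % N`; a line of
  -- direction `i` is a level set of row plus `i` times column.
  height : Fin M → Fin n → ℕ
  height i u = toℕ u % N + toℕ i * (toℕ u / N)

  height-< : ∀ i u → height i u < suc M * N
  height-< i u = +-mono-<-≤ (m%n<n (toℕ u) N)
    (*-mono-≤ (<⇒≤ (toℕ<n i)) (<⇒≤ (m<n*o⇒m/o<n {toℕ u} {N} {N} (<-≤-trans (toℕ<n u) n≤N*N))))

  line : Fin M → Fin n → Fin (suc M * N)
  line i u = fromℕ< (height-< i u)

  line-inj : ∀ {i j u v} → i ≢ j → line i u ≡ line i v → line j u ≡ line j v → u ≡ v
  line-inj {i} {j} {u} {v} i≢j eqᵢ eqⱼ = toℕ-injective (trans (m≡m%n+[m/n]*n (toℕ u) N)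
    (trans (cong₂ (λ y x → y + x * N) y≡ x≡) (sym (m≡m%n+[m/n]*n (toℕ v) N))))
    where
    hᵢ : height i u ≡ height i v
    hᵢ = fromℕ<-injective _ _ (height-< i u) (height-< i v) eqᵢ
    hⱼ : height j u ≡ height j v
    hⱼ = fromℕ<-injective _ _ (height-< j u) (height-< j v) eqⱼ
    x≡ : toℕ u / N ≡ toℕ v / N
    x≡ with <-cmp (toℕ u / N) (toℕ v / N)
    ... | tri< lt _ _ = ⊥-elim (i≢j (toℕ-injective (intercept-< (toℕ i) (toℕ j) lt hᵢ hⱼ)))
    ... | tri≈ _ eq _ = eq
    ... | tri> _ _ gt = ⊥-elim (i≢j (toℕ-injective (intercept-< (toℕ i) (toℕ j) gt (sym hᵢ) (sym hⱼ))))
    y≡ : toℕ u % N ≡ toℕ v % N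
    y≡ = +-cancelʳ-≡ (toℕ i * (toℕ u / N)) _ _ (trans hᵢ (cong (λ x → toℕ v % N + toℕ i * x) (sym x≡)))

-- Numerical inequalities

^-distribʳ-* : ∀ a b k → (a * b) ^ k ≡ a ^ k * b ^ k
^-distribʳ-* a b zero    = refl
^-distribʳ-* a b (suc k) = trans (cong (a * b *_) (^-distribʳ-* a b k))
  (solve 4 (λ a b x y → a :* b :* (x :* y) := a :* x :* (b :* y)) refl a b (a ^ k) (b ^ k))
  where open +-*-Solver

-- The first two terms of the binomial expansion.
bernoulli : ∀ a k → a ^ suc k + suc k * a ^ k ≤ suc a ^ suc k
bernoulli a zero    = ≤-reflexive (solve 1 (λ a → a :* con 1 :+ con 1 := (con 1 :+ a) :* con 1) refl a)
  where open +-*-Solver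
bernoulli a (suc k) = begin
  a * (a * x) + suc (suc k) * (a * x)
    ≤⟨ m≤m+n _ (suc k * x) ⟩
  a * (a * x) + suc (suc k) * (a * x) + suc k * x
    ≡⟨ solve 3 (λ a k x → a :* (a :* x) :+ (con 2 :+ k) :* (a :* x) :+ (con 1 :+ k) :* x
          := (con 1 :+ a) :* (a :* x :+ (con 1 :+ k) :* x)) refl a k x ⟩
  suc a * (a * x + suc k * x)
    ≤⟨ *-monoʳ-≤ (suc a) (bernoulli a k) ⟩
  suc a ^ suc (suc k) ∎
  where
  open ≤-Reasoning
  open +-*-Solver
  x = a ^ k

-- So `suc a` independent trials that each fail with probability `a / suc a` all fail with
-- probability at most one half. With `suc a` equal to `s ^ s` this is the origin of the factor
-- `s ^ s` in the number of directions.
2*a^[1+a]≤[1+a]^[1+a] : ∀ a → 2 * a ^ suc a ≤ suc a ^ suc a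
2*a^[1+a]≤[1+a]^[1+a] a = ≤-trans
  (+-monoʳ-≤ (a ^ suc a) (≤-trans (≤-reflexive (+-identityʳ _)) (*-monoˡ-≤ (a ^ a) (n≤1+n a))))
  (bernoulli a a)

-- `N` is raised by one only when `n` has outgrown `N * N`; then the old square is at most the old
-- `n`, which gives the upper bound.
square-root : ∀ n → 0 < n → ∃ λ N → 0 < N × n ≤ N * N × N * N ≤ 4 * n
square-root (suc zero) _ = 1 , s≤s z≤n , s≤s z≤n , s≤s z≤n
square-root (suc n@(suc _)) _ with square-root n (s≤s z≤n)
... | N , 0<N , n≤ , ≤4n with suc n ≤? N * N
...   | yes le = N , 0<N , le , ≤-trans ≤4n (*-monoʳ-≤ 4 (n≤1+n n))
...   | no  ≰  = suc N , s≤s z≤n ,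
        ≤-trans (s≤s n≤) (≤-trans (m≤m+n _ (2 * N)) (≤-reflexive (expand N))) , upper
  where
  open +-*-Solver
  open ≤-Reasoning
  expand : ∀ N → suc (N * N) + 2 * N ≡ suc N * suc N
  expand = solve 1 (λ N → con 1 :+ N :* N :+ con 2 :* N := (con 1 :+ N) :* (con 1 :+ N)) refl
  N*N≤n : N * N ≤ n
  N*N≤n = ≤-pred (≰⇒> ≰)
  N≤n : N ≤ n
  N≤n = ≤-trans (≤-trans (≤-reflexive (sym (*-identityʳ N))) (*-monoʳ-≤ N 0<N)) N*N≤n
  upper : suc N * suc N ≤ 4 * suc n
  upper = begin
    suc N * suc N         ≡⟨ expand N ⟨
    suc (N * N) + 2 * N   ≤⟨ +-mono-≤ (s≤s N*N≤n) (*-monoʳ-≤ 2 N≤n) ⟩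
    suc n + 2 * n         ≤⟨ m≤m+n _ (3 + n) ⟩
    suc n + 2 * n + (3 + n)
      ≡⟨ solve 1 (λ n → con 1 :+ n :+ con 2 :* n :+ (con 3 :+ n) := con 4 :* (con 1 :+ n)) refl n ⟩
    4 * suc n             ∎

⌈log₂⌉≤⇒≤2^ : ∀ L n → ⌈log₂ n ⌉ ≤ L → n ≤ 2 ^ L
⌈log₂⌉≤⇒≤2^ zero n le with n ≤? 1
... | yes n≤1 = n≤1
... | no  n≰1 with () ← ≤-trans (⌈log₂⌉-mono-≤ {2} {n} (≰⇒> n≰1)) le
⌈log₂⌉≤⇒≤2^ (suc L) n le = begin
  n                         ≡⟨ ⌊n/2⌋+⌈n/2⌉≡n n ⟨
  ⌊ n /2⌋ + ⌈ n /2⌉         ≤⟨ +-mono-≤ (≤-trans (⌊n/2⌋≤⌈n/2⌉ n) half)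
                                 (≤-trans half (≤-reflexive (sym (+-identityʳ _)))) ⟩
  2 ^ suc L                 ∎
  where
  open ≤-Reasoning
  half : ⌈ n /2⌉ ≤ 2 ^ L
  half = ⌈log₂⌉≤⇒≤2^ L ⌈ n /2⌉ (≤-trans (≤-reflexive (⌈log₂⌈n/2⌉⌉≡⌈log₂n⌉∸1 n)) (pred-mono-≤ le))

-- Each of the `suc k` points costs at most `L` bits, and each of its `h` coincidences gains one
-- bit, because there are twice as many classes as codes of a trial.
union-classes : ∀ {n L} k h T → 0 < T → n ≤ 2 ^ L → L < h →
  n ^ suc k * T ^ (suc k * h) < (2 * T) ^ (suc k * h)
union-classes {n} {L} k h T 0<T n≤ L<h = begin-strict
  n ^ suc k * T ^ e          ≤⟨ *-monoˡ-≤ (T ^ e) (^-monoˡ-≤ (suc k) n≤) ⟩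
  (2 ^ L) ^ suc k * T ^ e    ≡⟨ cong (_* T ^ e) (^-*-assoc 2 L (suc k)) ⟩
  2 ^ (L * suc k) * T ^ e    <⟨ *-monoˡ-< (T ^ e) (^-monoʳ-< 2 (s≤s (s≤s z≤n)) exponent) ⟩
  2 ^ e * T ^ e              ≡⟨ ^-distribʳ-* 2 T e ⟨
  (2 * T) ^ e                ∎
  where
  open ≤-Reasoning
  e = suc k * h
  instance
    _ = >-nonZero 0<T
    _ = m^n≢0 T e
  exponent : L * suc k < e
  exponent = subst (_< e) (*-comm (suc k) L) (*-monoʳ-< (suc k) L<h)

-- Choosing the vertices costs at most `L * (q + q * s)` bits. Every `suc a` trials gain one bit,
-- `(s + 2) * L * q` in all, which leaves a surplus of `L * q`.
union-colours : ∀ {n L} s a q → 0 < L → 0 < q → 0 < a → n ≤ 2 ^ L →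
  n ^ (q + q * s) * a ^ (suc a * ((s + 2) * L) * q) < suc a ^ (suc a * ((s + 2) * L) * q)
union-colours {n} {L} s a q 0<L 0<q 0<a n≤ = begin-strict
  n ^ (q + q * s) * a ^ (suc a * ((s + 2) * L) * q)
    ≡⟨ cong (λ z → n ^ (q + q * s) * a ^ z) (*-assoc (suc a) ((s + 2) * L) q) ⟩
  n ^ (q + q * s) * a ^ (suc a * e)
    ≤⟨ *-monoˡ-≤ _ (≤-trans (^-monoˡ-≤ (q + q * s) n≤) (≤-reflexive (^-*-assoc 2 L (q + q * s)))) ⟩
  2 ^ (L * (q + q * s)) * a ^ (suc a * e)
    <⟨ *-monoˡ-< (a ^ (suc a * e)) (^-monoʳ-< 2 (s≤s (s≤s z≤n)) exponent) ⟩
  2 ^ e * a ^ (suc a * e)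
    ≡⟨ cong (2 ^ e *_) (^-*-assoc a (suc a) e) ⟨
  2 ^ e * (a ^ suc a) ^ e
    ≡⟨ ^-distribʳ-* 2 (a ^ suc a) e ⟨
  (2 * a ^ suc a) ^ e
    ≤⟨ ^-monoˡ-≤ e (2*a^[1+a]≤[1+a]^[1+a] a) ⟩
  (suc a ^ suc a) ^ e
    ≡⟨ trans (^-*-assoc (suc a) (suc a) e) (cong (suc a ^_) (sym (*-assoc (suc a) ((s + 2) * L) q))) ⟩
  suc a ^ (suc a * ((s + 2) * L) * q) ∎
  where
  open ≤-Reasoning
  open +-*-Solver
  e = (s + 2) * L * q
  instance
    _ = >-nonZero 0<a
    _ = m^n≢0 a (suc a * e)
  exponent : L * (q + q * s) < e
  exponent = begin-strict
    L * (q + q * s)           <⟨ m<m+n _ (*-mono-≤ 0<L 0<q) ⟩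
    L * (q + q * s) + L * q
      ≡⟨ solve 3 (λ s L q → L :* (q :+ q :* s) :+ L :* q := (s :+ con 2) :* L :* q) refl s L q ⟩
    e                         ∎

-- Choice of the parameters

module Parameters (s L : ℕ) (0<s : 0 < s) (0<L : 0 < L) where

  -- `L` stands for the logarithm and `C` depends on `s` alone. `M` is dictated by `union-colours`
  -- with `suc a` equal to `s ^ s`, `k` by the pigeonhole over direction pairs with `h` equal to
  -- `L`, `R` by `union-classes`, and `K₀` bounds `ramseyBound s (suc k)`.
  C M k R K₀ : ℕ
  C  = s ^ s * (s + 2)
  M  = s ^ s * ((s + 2) * L)
  k  = M * M * suc L
  R  = 2 * (suc k * (M * M))
  K₀ = suc (suc k) ^ s

  -- The leftover `ℓ * R * K₀` of `clean-blocks` on the grid, where `ℓ` is `suc M * N`. It also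
  -- serves as the number `q` of blocks in each direction.
  cells : ℕ → ℕ
  cells N = suc M * N * R * K₀

  0<C : 0 < C
  0<C = *-mono-≤ (m^n>0 s {{>-nonZero 0<s}} s) (≤-trans (s≤s z≤n) (m≤n+m 2 s))

  M≡C*L : M ≡ C * L
  M≡C*L = sym (*-assoc (s ^ s) (s + 2) L)

  0<M : 0 < M
  0<M = subst (0 <_) (sym M≡C*L) (*-mono-≤ 0<C 0<L)

  0<k : 0 < k
  0<k = *-mono-≤ (*-mono-≤ 0<M 0<M) (s≤s {0} {L} z≤n)

  constant : ℕ
  constant = (1 + s) * (16 * (C * C * C * C * C)) * (8 * (C * C)) ^ s

  1+n≤2n : ∀ {n} → 0 < n → suc n ≤ 2 * n
  1+n≤2n {n} 0<n = +-mono-≤ 0<n (≤-reflexive (sym (+-identityʳ n)))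

  open ≤-Reasoning
  open +-*-Solver

  k-bound : suc k ≤ 4 * (C * C) * (L * L * L)
  k-bound = begin
    suc k                      ≤⟨ 1+n≤2n 0<k ⟩
    2 * (M * M * suc L)        ≤⟨ *-monoʳ-≤ 2 (*-monoʳ-≤ (M * M) (1+n≤2n 0<L)) ⟩
    2 * (M * M * (2 * L))      ≡⟨ cong (λ M → 2 * (M * M * (2 * L))) M≡C*L ⟩
    2 * (C * L * (C * L) * (2 * L))
      ≡⟨ solve 2 (λ C L → con 2 :* (C :* L :* (C :* L) :* (con 2 :* L))
           := con 4 :* (C :* C) :* (L :* L :* L)) refl C L ⟩
    4 * (C * C) * (L * L * L)  ∎

  R-bound : R ≤ 8 * (C * C * C * C) * (L * L * L * L * L)
  R-bound = begin
    2 * (suc k * (M * M))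
      ≤⟨ *-monoʳ-≤ 2 (*-monoˡ-≤ (M * M) k-bound) ⟩
    2 * (4 * (C * C) * (L * L * L) * (M * M))
      ≡⟨ cong (λ M → 2 * (4 * (C * C) * (L * L * L) * (M * M))) M≡C*L ⟩
    2 * (4 * (C * C) * (L * L * L) * (C * L * (C * L)))
      ≡⟨ solve 2 (λ C L → con 2 :* (con 4 :* (C :* C) :* (L :* L :* L) :* (C :* L :* (C :* L)))
           := con 8 :* (C :* C :* C :* C) :* (L :* L :* L :* L :* L)) refl C L ⟩
    8 * (C * C * C * C) * (L * L * L * L * L) ∎

  K₀-bound : K₀ ≤ (8 * (C * C)) ^ s * L ^ (3 * s)
  K₀-bound = begin
    suc (suc k) ^ s
      ≤⟨ ^-monoˡ-≤ s (≤-trans (1+n≤2n (s≤s z≤n)) (*-monoʳ-≤ 2 k-bound)) ⟩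
    (2 * (4 * (C * C) * (L * L * L))) ^ s
      ≡⟨ cong (_^ s) (solve 2 (λ C L → con 2 :* (con 4 :* (C :* C) :* (L :* L :* L))
           := con 8 :* (C :* C) :* (L :* (L :* (L :* con 1)))) refl C L) ⟩
    (8 * (C * C) * L ^ 3) ^ s
      ≡⟨ ^-distribʳ-* (8 * (C * C)) (L ^ 3) s ⟩
    (8 * (C * C)) ^ s * (L ^ 3) ^ s
      ≡⟨ cong ((8 * (C * C)) ^ s *_) (^-*-assoc L 3 s) ⟩
    (8 * (C * C)) ^ s * L ^ (3 * s) ∎

  -- The exponent collects one factor `L` from `M`, five from `R` and `3 * s` from `K₀`.
  size-bound : ∀ N → cells N + cells N * s ≤ constant * L ^ (6 + 3 * s) * N
  size-bound N = begin
    cells N + cells N * s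
      ≡⟨ solve 2 (λ x s → x :+ x :* s := (con 1 :+ s) :* x) refl (cells N) s ⟩
    (1 + s) * (suc M * N * R * K₀)
      ≤⟨ *-monoʳ-≤ (1 + s) (*-mono-≤ (*-mono-≤ (*-monoˡ-≤ N
           (≤-trans (1+n≤2n 0<M) (≤-reflexive (cong (2 *_) M≡C*L)))) R-bound) K₀-bound) ⟩
    (1 + s) * (2 * (C * L) * N * (8 * (C * C * C * C) * (L * L * L * L * L)) * ((8 * (C * C)) ^ s * L ^ (3 * s)))
      ≡⟨ solve 6 (λ s C L N A B →
           (con 1 :+ s) :* (con 2 :* (C :* L) :* N
             :* (con 8 :* (C :* C :* C :* C) :* (L :* L :* L :* L :* L)) :* (A :* B))
           := (con 1 :+ s) :* (con 16 :* (C :* C :* C :* C :* C)) :* A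
             :* (L :* (L :* (L :* (L :* (L :* (L :* con 1))))) :* B) :* N)
           refl s C L N ((8 * (C * C)) ^ s) (L ^ (3 * s)) ⟩
    constant * (L ^ 6 * L ^ (3 * s)) * N
      ≡⟨ cong (λ z → constant * z * N) (^-distribˡ-+-* L 6 (3 * s)) ⟨
    constant * L ^ (6 + 3 * s) * N ∎

  square-bound : ∀ {N n w} → 3 ≤ s → N * N ≤ 4 * n → w ≤ cells N + cells N * s →
    w * w ≤ suc (4 * (constant * constant)) * L ^ (8 * (s * s)) * n
  square-bound {N} {n} {w} 3≤s N*N≤ w≤ = begin
    w * w                                            ≤⟨ *-mono-≤ w≤′ w≤′ ⟩
    c * x * N * (c * x * N)
      ≡⟨ solve 3 (λ c x N → c :* x :* N :* (c :* x :* N) := c :* c :* (x :* x) :* (N :* N)) refl c x N ⟩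
    c * c * (x * x) * (N * N)                        ≤⟨ *-mono-≤ (*-monoʳ-≤ (c * c) x*x≤) N*N≤ ⟩
    c * c * y * (4 * n)
      ≡⟨ solve 3 (λ c y n → c :* c :* y :* (con 4 :* n) := con 4 :* (c :* c) :* y :* n) refl c y n ⟩
    -- The `suc` makes the final constant visibly positive.
    4 * (c * c) * y * n                              ≤⟨ *-monoˡ-≤ n (*-monoˡ-≤ y (n≤1+n (4 * (c * c)))) ⟩
    suc (4 * (c * c)) * y * n                        ∎
    where
    c = constant
    x = L ^ (6 + 3 * s)
    y = L ^ (8 * (s * s))
    w≤′ : w ≤ c * x * N
    w≤′ = ≤-trans w≤ (size-bound N)
    -- A crude comparison through `24 * s`; both its ends use `3 ≤ s`.
    exponent : 6 + 3 * s + (6 + 3 * s) ≤ 8 * (s * s)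
    exponent = begin
      6 + 3 * s + (6 + 3 * s)
        ≡⟨ solve 1 (λ s → con 6 :+ con 3 :* s :+ (con 6 :+ con 3 :* s)
             := con 4 :* con 3 :+ con 6 :* s) refl s ⟩
      4 * 3 + 6 * s            ≤⟨ +-monoˡ-≤ (6 * s) (*-monoʳ-≤ 4 3≤s) ⟩
      4 * s + 6 * s            ≤⟨ m≤m+n _ (14 * s) ⟩
      4 * s + 6 * s + 14 * s
        ≡⟨ solve 1 (λ s → con 4 :* s :+ con 6 :* s :+ con 14 :* s := con 8 :* (con 3 :* s)) refl s ⟩
      8 * (3 * s)              ≤⟨ *-monoʳ-≤ 8 (*-monoˡ-≤ s 3≤s) ⟩
      8 * (s * s)              ∎
    x*x≤ : x * x ≤ y
    x*x≤ = ≤-trans (≤-reflexive (sym (^-distribˡ-+-* L (6 + 3 * s) (6 + 3 * s))))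
      (^-monoʳ-≤ L {{>-nonZero 0<L}} exponent)

-- Assembly of the construction

module Construction {n M ℓ : ℕ} (π : Fin M → Fin n → Fin ℓ)
  (π-inj : ∀ {i j u v} → i ≢ j → π i u ≡ π i v → π j u ≡ π j v → u ≡ v) where

  open Lines π π-inj

  KFree-subset-≤ : ∀ {R s m} (c : Vec (Fin R) (M * n)) (d : Vec (Fin s) (M * n)) → RichIn c d m →
    ∀ W → KFreeIn s (graph c d) W → ∣ W ∣ ≤ m
  KFree-subset-≤ {R} {s} {m} c d rich W W-free with m ≤? ∣ W ∣
  ... | no  ≰  = ≰⇒≥ ≰
  ... | yes le = ⊥-elim (rich f f-inj λ T T∈ T-inj T-adj → W-free
        (T , (T-inj _ _ , λ t t′ t≢t′ → dec-true (adjacent? c d (T t) (T t′)) (T-adj t t′ t≢t′))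
           , λ t → let a , eq = T∈ t in subst (_∈ₛ W) (sym eq) (f∈ a)))
    where
    f : Fin m → Fin n
    f a = proj₁ (enumerate W) (inject≤ a le)
    f-inj : ∀ a b → f a ≡ f b → a ≡ b
    f-inj a b eq = inject≤-injective le le a b (proj₁ (proj₂ (enumerate W)) _ _ eq)
    f∈ : ∀ a → f a ∈ₛ W
    f∈ a = proj₂ (proj₂ (enumerate W)) (inject≤ a le)

  small-KFree-subsets : ∀ R k h s α q → 0 < R → 0 < s → 0 < n → suc α ≡ s ^ s → M * M * h < k →
    n ^ suc k * (suc k * (M * M)) ^ (suc k * suc h) < R ^ (suc k * suc h) →
    let m = ℓ * R * suc (suc k) ^ s + q * s in
    n ^ m * α ^ (M * q) < (s ^ s) ^ (M * q) →
    Σ (Graph n) λ G → KFree (suc s) G × (∀ W → KFreeIn s G W → ∣ W ∣ ≤ m)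
  small-KFree-subsets R k h s α q 0<R 0<s 0<n α+1≡s^s M*M*h<k few-dirty few-missed =
    let c , no-dirty = exists-classes R k h {{>-nonZero 0<R}} M*M*h<k few-dirty
        d , rich = exists-colours c s (suc k) (suc (suc k) ^ s) q α {{>-nonZero 0<s}} (fromℕ< 0<n) 0<s
          no-dirty (<⇒≤ (ramseyBound-< s (suc k))) α+1≡s^s few-missed
    in graph c d , graph-KFree s 0<s c d , KFree-subset-≤ c d rich

grid-graph : ∀ s L N n (3≤s : 3 ≤ s) (0<s : 0 < s) (0<L : 0 < L) →
  0 < N → n ≤ N * N → 0 < n → n ≤ 2 ^ L →
  let open Parameters s L 0<s 0<L in
  Σ (Graph n) λ G → KFree (suc s) G × (∀ W → KFreeIn s G W → ∣ W ∣ ≤ cells N + cells N * s)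
grid-graph s L N n 3≤s 0<s 0<L 0<N n≤N*N 0<n n≤2^L =
  -- With `h` equal to `L`, each point has `suc L` coincidences, one more than the bits needed to
  -- name it.
  small-KFree-subsets R k L s α (cells N) 0<R 0<s 0<n α+1≡s^s (*-monoʳ-< (M * M) ≤-refl)
    (union-classes {n} {L} k (suc L) (suc k * (M * M)) 0<T n≤2^L ≤-refl)
    (subst (λ P → n ^ (cells N + cells N * s) * α ^ (P * ((s + 2) * L) * cells N)
                    < P ^ (P * ((s + 2) * L) * cells N))
      α+1≡s^s (union-colours {n} {L} s α (cells N) 0<L 0<cells 0<α n≤2^L))
  where
  open Parameters s L 0<s 0<L
  0<T : 0 < suc k * (M * M)
  0<T = *-mono-≤ {1} {suc k} (s≤s z≤n) (*-mono-≤ 0<M 0<M)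
  0<R : 0 < R
  0<R = *-mono-≤ {1} {2} (s≤s z≤n) 0<T
  instance
    N≢0 : NonZero N
    N≢0 = >-nonZero 0<N
    M*M≢0 : NonZero (M * M)
    M*M≢0 = >-nonZero (*-mono-≤ 0<M 0<M)
    s≢0 : NonZero s
    s≢0 = >-nonZero 0<s
    s^s≢0 : NonZero (s ^ s)
    s^s≢0 = m^n≢0 s s
  open Grid N M n n≤N*N
  open Construction line line-inj
  α = pred (s ^ s)
  α+1≡s^s : suc α ≡ s ^ s
  α+1≡s^s = suc-pred (s ^ s)
  0<cells : 0 < cells N
  0<cells = *-mono-≤ (*-mono-≤ (*-mono-≤ {1} {suc M} (s≤s z≤n) 0<N) 0<R) (m^n>0 (suc (suc k)) s)
  0<α : 0 < α
  0<α = pred-mono-≤ {2} (≤-trans (≤-trans (n≤1+n 2) 3≤s)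
    (≤-trans (≤-reflexive (sym (*-identityʳ s))) (^-monoʳ-≤ s {1} {s} 0<s)))

-- The bound is squared, which turns `4 s²` into `8 s²` and `√n` into `n`. For `n ≥ 2`, `⌈log₂ n ⌉`
-- is at most `2 / log 2` times the natural logarithm, so the change of logarithm only affects the
-- constant.
theorem1 : ∀ (s : ℕ) → 3 ≤ s →
    Σ ℕ λ c → 0 < c ×
    (∀ (n : ℕ) → 2 ≤ n →
    fSqLe s (s + 1) n (c * (⌈log₂ n ⌉ ^ (8 * (s * s))) * n))
theorem1 s 3≤s = suc (4 * (constant * constant)) , s≤s z≤n , bound
  where
  0<s : 0 < s
  0<s = ≤-trans (s≤s z≤n) 3≤s
  -- `constant` does not involve `L`, so the value 1 merely serves to name it before `n` is given.
  open Parameters s 1 0<s ≤-refl using (constant)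
  bound : ∀ n → 2 ≤ n →
    fSqLe s (s + 1) n (suc (4 * (constant * constant)) * (⌈log₂ n ⌉ ^ (8 * (s * s))) * n)
  bound n 2≤n =
    let 0<n = ≤-trans (s≤s z≤n) 2≤n
        0<L = ⌈log₂⌉-mono-≤ {2} 2≤n
        N , 0<N , n≤N*N , N*N≤4n = square-root n 0<n
        G , G-free , small = grid-graph s ⌈log₂ n ⌉ N n 3≤s 0<s 0<L 0<N n≤N*N 0<n
          (⌈log₂⌉≤⇒≤2^ ⌈log₂ n ⌉ n ≤-refl)
    in G , subst (λ t → KFree t G) (+-comm 1 s) G-free
         , λ W W-free →
             Parameters.square-bound s ⌈log₂ n ⌉ 0<s 0<L {N} {n} 3≤s N*N≤4n (small W W-free)
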